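{- Let $f(x)\in\mathbf{Z}[x]$ be a separable nonconstant polynomial of odd degree, let $C$ be the hyperelliptic curve $y^2=f(x)$, and let $g$ be the genus of $C$. Let $N_0$ be an integer such that every prime $\ell\ge N_0$ satisfies: (a) $\ell$ is good for $f(x)$; and (b) for every smooth projective curve $X/\mathbf{F}_\ell$ of genus $g$, $\#X(\mathbf{F}_\ell)\ge 2g+5$. Let $p\ge N_0$ be prime, and let $m$ be an integer coprime to $p$. Then there exist infinitely many squarefree integers $d\equiv m\pmod p$ such that the curve $C_d$ has a nontrivial point over every completion of $\mathbf{Q}$.
   Context: Squarefree integers may be negative and are nonzero. An odd prime $\ell$ is good for $f(x)$ if the reduced polynomial $\bar f(x)\in\mathbf{F}_\ell[x]$ has the same degree as $f(x)$ and has nonzero discriminant. The curve $y^2=f(x)$ (in its smooth projective model) has genus $g$ where $\deg f\in\{2g+1,2g+2\}$; $g=0$ is allowed. Smooth projective curves over $\mathbf{F}_\ell$ are understood to be geometrically irreducible. For a squarefree integer $d$, $C_d$ denotes the quadratic twist $dy^2=f(x)$. Points of $C_d$ at infinity and affine points $(x,y)$ with $f(x)=0$ are called trivial; thus $C_d$ has a nontrivial point over a field $K\supseteq\mathbf{Q}$ if and only if there exist $x,y\in K$ with $dy^2=f(x)$ and $f(x)\ne 0$. The completions of $\mathbf{Q}$ are $\mathbf{R}$ and $\mathbf{Q}_\ell$ for all primes $\ell$. -}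

module Defs where

open import Algebra.Bundles using (CommutativeRing; Semiring)
open import Algebra.Morphism.Structures using (module RingMorphisms)
import Algebra.Definitions.RawSemiring as RawSemiringDefs
open import Data.Bool.Base using (if_then_else_)
open import Data.Fin.Base using (Fin; zero; suc; toℕ; splitAt; punchIn)
open import Data.Integer.Base as ℤ using (ℤ; +_)
import Data.Integer.Divisibility as ℤᵈ
import Data.Integer.Divisibility.Signed as ℤˢ
import Data.Integer.Properties as ℤᵖ
open import Data.Integer.Tactic.RingSolver using (solve-∀)
open import Data.List.Base as List using (List; []; _∷_; _++_)
open import Data.List.Membership.Propositional using (_∉_)
open import Data.Nat.Base as ℕ using (ℕ; zero; suc)
import Data.Nat.Divisibility as ℕᵈ
import Data.Nat.DivMod as ℕᵐ
import Data.Nat.Induction as ℕᵢ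
open import Data.Nat.Primality as Prime using (Prime)
import Data.Nat.Properties as ℕᵖ
open import Data.Product.Base using (Σ; ∃; ∃-syntax; _×_; _,_; proj₁; proj₂)
open import Data.Rational.Base as ℚ using (ℚ; mkℚ; _/_)
import Data.Rational.Properties as ℚᵖ
open import Data.Rational.Solver using (module +-*-Solver)
import Data.Rational.Unnormalised.Base as ℚᵘ
import Data.Rational.Unnormalised.Properties as ℚᵘᵖ
open import Data.Sum.Base using (_⊎_; inj₁; inj₂; [_,_]′)
open import Data.Vec.Base as Vec using (Vec)
import Data.Vec.Functional as Vector
import Data.Vec.Properties as Vecᵖ
open import Function.Definitions using (Injective)
open import Induction.WellFounded using (Acc; acc)
open import Level using (0ℓ)
open import Relation.Binary.PropositionalEquality
  using (_≡_; _≢_; refl; sym; trans; cong; cong₂; subst; subst₂; module ≡-Reasoning)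
open import Relation.Nullary using (¬_; Dec; yes; no)
open import Relation.Nullary.Decidable using (⌊_⌋)

Ring : Set₁
Ring = CommutativeRing 0ℓ 0ℓ

module Univariate (R : Ring) where
  open CommutativeRing R hiding (zero; sym; trans; refl)
  open RawSemiringDefs (Semiring.rawSemiring semiring) using (sum; _^_)
    renaming (_×_ to _·_)

  -- Coefficients in order of increasing degree; trailing zeros are allowed,
  -- so polynomials are compared through their coefficients.
  Poly : Set
  Poly = List Carrier

  coeff : Poly → ℕ → Carrier
  coeff []      _       = 0#
  coeff (a ∷ p) zero    = a
  coeff (a ∷ p) (suc k) = coeff p k

  infix 4 _≋_
  _≋_ : Poly → Poly → Set
  p ≋ q = ∀ k → coeff p k ≈ coeff q k

  HasDegree : Poly → ℕ → Set
  HasDegree p n = ¬ coeff p n ≈ 0# × (∀ k → n ℕ.< k → coeff p k ≈ 0#)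

  eval : Poly → Carrier → Carrier
  eval []      x = 0#
  eval (a ∷ p) x = a + x * eval p x

  infixl 6 _⊕_
  _⊕_ : Poly → Poly → Poly
  []      ⊕ q       = q
  (a ∷ p) ⊕ []      = a ∷ p
  (a ∷ p) ⊕ (b ∷ q) = (a + b) ∷ (p ⊕ q)

  infixl 7 _⊛_
  _⊛_ : Poly → Poly → Poly
  []      ⊛ q = []
  (a ∷ p) ⊛ q = List.map (a *_) q ⊕ (0# ∷ (p ⊛ q))

  deriv : Poly → Poly
  deriv []      = []
  deriv (_ ∷ p) = go 1 p
    where
    go : ℕ → Poly → Poly
    go i []      = []
    go i (a ∷ p) = (i · a) ∷ go (suc i) p

  Separable : Poly → Set
  Separable p = ∃[ a ] ∃[ b ] (a ⊛ p) ⊕ (b ⊛ deriv p) ≋ 1# ∷ []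

  det : ∀ {n} → (Fin n → Fin n → Carrier) → Carrier
  det {zero}  M = 1#
  det {suc n} M = sum λ j →
    (- 1#) ^ toℕ j * (M zero j * det λ i k → M (suc i) (punchIn j k))

  -- The Sylvester matrix of p and q, regarded as having degrees m and n:
  -- n shifted rows of p above m shifted rows of q, columns in order of
  -- decreasing degree.  In row r of p the entry in column j is the coefficient
  -- of index m - (j - r); for j < r this index exceeds m.
  sylvester : (m n : ℕ) → Poly → Poly → Fin (n ℕ.+ m) → Fin (n ℕ.+ m) → Carrier
  sylvester m n p q i j =
    [ (λ r → entry p m (toℕ r)) , (λ r → entry q n (toℕ r)) ]′ (splitAt n i)
    where
    entry : Poly → ℕ → ℕ → Carrier
    entry s e r = if toℕ j ℕ.≤ᵇ e ℕ.+ r then coeff s (e ℕ.+ r ℕ.∸ toℕ j) else 0#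

  resultant : (m n : ℕ) → Poly → Poly → Carrier
  resultant m n p q = det (sylvester m n p q)

  -- aₙ · Disc p = (-1)^(n(n-1)/2) · Res(p , p′) for p of degree n ≥ 1 with
  -- leading coefficient aₙ.  Here p′ is given the formal degree n - 1, also
  -- when the characteristic divides n.
  IsDiscriminant : Poly → ℕ → Carrier → Set
  IsDiscriminant p n D =
    coeff p n * D ≈ (- 1#) ^ (n ℕ.* (n ℕ.∸ 1) ℕ./ 2) * resultant n (n ℕ.∸ 1) p (deriv p)

-- Equality is required to be decidable, which is no restriction classically.
IsField : Ring → Set
IsField K = (∀ x y → Dec (x ≈ y)) × ¬ 1# ≈ 0# × (∀ x → ¬ x ≈ 0# → ∃[ y ] x * y ≈ 1#)
  where open CommutativeRing K

IsAlgebraicallyClosed : Ring → Set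
IsAlgebraicallyClosed K =
  IsField K × (∀ p n → HasDegree p n → 1 ℕ.≤ n → ∃[ x ] eval p x ≈ 0#)
  where
  open CommutativeRing K
  open Univariate K

record AlgebraicallyClosedExtension (F : Ring) : Set₁ where
  field
    K         : Ring
    algClosed : IsAlgebraicallyClosed K
    ι         : CommutativeRing.Carrier F → CommutativeRing.Carrier K
    ι-hom     : RingMorphisms.IsRingHomomorphism
                  (CommutativeRing.rawRing F) (CommutativeRing.rawRing K) ι

module Multivariate (R : Ring) (N : ℕ) where
  open CommutativeRing R hiding (zero; sym; trans; refl)
  open RawSemiringDefs (Semiring.rawSemiring semiring) using (sum; product; _^_)
    renaming (_×_ to _·_)

  -- A polynomial in N variables is a list of terms (coefficient , exponents);
  -- exponents may be repeated.
  MvPoly : Set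
  MvPoly = List (Carrier × Vec ℕ N)

  coeff : MvPoly → Vec ℕ N → Carrier
  coeff []            e = 0#
  coeff ((a , d) ∷ p) e =
    (if ⌊ Vecᵖ.≡-dec ℕᵖ._≟_ d e ⌋ then a else 0#) + coeff p e

  infix 4 _≋_
  _≋_ : MvPoly → MvPoly → Set
  p ≋ q = ∀ e → coeff p e ≈ coeff q e

  infixl 6 _⊕_
  _⊕_ : MvPoly → MvPoly → MvPoly
  _⊕_ = _++_

  infixl 7 _⊛_
  _⊛_ : MvPoly → MvPoly → MvPoly
  _⊛_ = List.cartesianProductWith λ (a , d) (b , e) → a * b , Vec.zipWith ℕ._+_ d e

  infixr 7 _∙_
  _∙_ : Carrier → MvPoly → MvPoly
  c ∙ p = List.map (λ (a , d) → c * a , d) p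

  Σᵖ : ∀ {s} → (Fin s → MvPoly) → MvPoly
  Σᵖ = Vector.foldr _⊕_ []

  IsHomogeneous : ℕ → MvPoly → Set
  IsHomogeneous k p = ∀ e → Vec.sum e ≢ k → coeff p e ≈ 0#

  eval : MvPoly → (Fin N → Carrier) → Carrier
  eval []            x = 0#
  eval ((a , e) ∷ p) x = a * product (λ i → x i ^ Vec.lookup e i) + eval p x

  ∂ : Fin N → MvPoly → MvPoly
  ∂ i = List.map λ (a , e) → Vec.lookup e i · a , Vec.updateAt e i ℕ.pred

  InIdeal : ∀ {s} → (Fin s → MvPoly) → MvPoly → Set
  InIdeal {s} gens p = Σ (Fin s → MvPoly) λ q → p ≋ Σᵖ (λ i → q i ⊛ gens i)

-- Row rank: r of the rows are linearly independent and span all the rows.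
HasRank : (K : Ring) → let open CommutativeRing K in
          ∀ {s t} → (Fin s → Fin t → Carrier) → ℕ → Set
HasRank K {s} M r = Σ (Fin r → Fin s) λ σ →
    (∀ (c : Fin r → Carrier) → (∀ j → sum (λ i → c i * M (σ i) j) ≈ 0#) → ∀ i → c i ≈ 0#)
  × (∀ k → Σ (Fin r → Carrier) λ c → ∀ j → M k j ≈ sum (λ i → c i * M (σ i) j))
  where
  open CommutativeRing K
  open RawSemiringDefs (Semiring.rawSemiring semiring) using (sum)

module Projective (F : Ring) where

  -- The closed subscheme of ℙⁿ cut out by finitely many forms.
  record ProjectiveScheme : Set where
    field
      n           : ℕ
      s           : ℕ
      form        : Fin s → Multivariate.MvPoly F (suc n)
      degree      : Fin s → ℕ
      homogeneous : ∀ i → Multivariate.IsHomogeneous F (suc n) (degree i) (form i)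

  module _ (X : ProjectiveScheme) where
    open ProjectiveScheme X

    -- K is an F-algebra through ι.
    module Points (K : Ring)
                  (ι : CommutativeRing.Carrier F → CommutativeRing.Carrier K) where
      open CommutativeRing K hiding (zero; sym; trans; refl)
      open Multivariate K (suc n) using (MvPoly; eval; ∂; IsHomogeneous)

      formK : Fin s → MvPoly
      formK i = List.map (λ (a , e) → ι a , e) (form i)

      record Point : Set where
        field
          coord   : Fin (suc n) → Carrier
          nonzero : ∃[ i ] ¬ coord i ≈ 0#
          onX     : ∀ i → eval (formK i) coord ≈ 0#
      open Point public

      infix 4 _∼_
      _∼_ : Point → Point → Set
      P ∼ Q = ∃[ c ] ¬ c ≈ 0# × (∀ i → coord P i ≈ c * coord Q i)

      jacobian : Point → Fin s → Fin (suc n) → Carrier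
      jacobian P i j = eval (∂ j (formK i)) (coord P)

      VanishesOnX : MvPoly → Set
      VanishesOnX a = ∀ P → eval a (coord P) ≈ 0#

      -- Irreducibility of the set of K-points in the Zariski topology: it is
      -- nonempty, and if two hypersurfaces a = 0 and b = 0 cover it, then one
      -- of them does.
      IsIrreducible : Set
      IsIrreducible = Point ×
        (∀ {k l} a b → IsHomogeneous k a → IsHomogeneous l b →
           (∀ P → eval a (coord P) ≈ 0# ⊎ eval b (coord P) ≈ 0#) →
           VanishesOnX a ⊎ VanishesOnX b)

    private
      open module F = CommutativeRing F using (Carrier; _≈_; 0#)
      open module P = Multivariate F (suc n) using (MvPoly; _⊕_; _∙_; Σᵖ; IsHomogeneous; InIdeal)

    IsGeometricallyIrreducible : Set₁
    IsGeometricallyIrreducible =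
      (E : AlgebraicallyClosedExtension F) → let open AlgebraicallyClosedExtension E in
      Points.IsIrreducible K ι

    -- Jacobian criterion at all geometric points, for X of pure dimension one:
    -- the rank is the codimension n - 1.  By Euler's relation the matrix of
    -- homogeneous partial derivatives has the same rank at a point of X as the
    -- affine Jacobian matrix in a chart.
    IsSmoothOfDimensionOne : Set₁
    IsSmoothOfDimensionOne =
      (E : AlgebraicallyClosedExtension F) → let open AlgebraicallyClosedExtension E in
      ∀ P → ∃[ r ] suc r ≡ n × HasRank K (Points.jacobian K ι P) r

    -- The degree k part of F[x₀,…,xₙ] modulo the ideal of forms has dimension D.
    HilbertFunction : ℕ → ℕ → Set
    HilbertFunction k D = Σ (Fin D → MvPoly) λ b →
        (∀ i → IsHomogeneous k (b i))
      × (∀ p → IsHomogeneous k p →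
           Σ (Fin D → Carrier) λ c → InIdeal form (p ⊕ Σᵖ (λ i → (F.- c i) ∙ b i)))
      × (∀ (c : Fin D → Carrier) → InIdeal form (Σᵖ (λ i → c i ∙ b i)) → ∀ i → c i ≈ 0#)

    -- X has Hilbert polynomial P(k) = e k + 1 - g with e ≥ 1: its dimension,
    -- the degree of P, is one, and its arithmetic genus 1 - P(0) is g.  For a
    -- smooth geometrically irreducible curve this is the genus.
    IsCurveOfGenus : ℕ → Set
    IsCurveOfGenus g = ∃[ e ] 1 ℕ.≤ e × ∃[ k₀ ] (∀ k → k₀ ℕ.≤ k →
      ∃[ D ] HilbertFunction k D × D ℕ.+ g ≡ e ℕ.* k ℕ.+ 1)

  record SmoothProjectiveCurve (g : ℕ) : Set₁ where
    field
      scheme      : ProjectiveScheme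
      genus       : IsCurveOfGenus scheme g
      smooth      : IsSmoothOfDimensionOne scheme
      irreducible : IsGeometricallyIrreducible scheme

  HasAtLeastPoints : ∀ {g} → SmoothProjectiveCurve g → ℕ → Set
  HasAtLeastPoints X N = Σ (Fin N → Point) λ pts → Injective _≡_ _∼_ pts
    where open Points (SmoothProjectiveCurve.scheme X) F (λ a → a)

open Projective public using (SmoothProjectiveCurve; HasAtLeastPoints)

infix 4 _≡_[mod_]
_≡_[mod_] : ℤ → ℤ → ℕ → Set
a ≡ b [mod n ] = + n ℤˢ.∣ a ℤ.- b

-- ℤ/n: the elements are the integers, equality is congruence modulo n.
ℤ/_ : ℕ → Ring
ℤ/ n = record
  { Carrier = ℤ
  ; _≈_     = λ a b → a ≡ b [mod n ]
  ; _+_     = ℤ._+_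
  ; _*_     = ℤ._*_
  ; -_      = ℤ.-_
  ; 0#      = ℤ.0ℤ
  ; 1#      = ℤ.1ℤ
  ; isCommutativeRing = record
    { isRing = record
      { +-isAbelianGroup = record
        { isGroup = record
          { isMonoid = record
            { isSemigroup = record
              { isMagma = record
                { isEquivalence = record
                  { refl  = λ {a} → reflexive {a} refl
                  ; sym   = λ {a} {b} → sym′ {a} {b}
                  ; trans = λ {a} {b} {c} → trans′ {a} {b} {c}
                  }
                ; ∙-cong = λ {a} {b} {c} {d} p q →
                    subst (+ n ℤˢ.∣_) (+-lemma a b c d) (ℤˢ.∣m∣n⇒∣m+n p q)
                }
              ; assoc = λ a b c → reflexive (ℤᵖ.+-assoc a b c)
              }
            ; identity = (λ a → reflexive (ℤᵖ.+-identityˡ a))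
                       , (λ a → reflexive (ℤᵖ.+-identityʳ a))
            }
          ; inverse = (λ a → reflexive (ℤᵖ.+-inverseˡ a))
                    , (λ a → reflexive (ℤᵖ.+-inverseʳ a))
          ; ⁻¹-cong = λ {a} {b} p → subst (+ n ℤˢ.∣_) (neg-lemma a b) (ℤˢ.∣m⇒∣-m p)
          }
        ; comm = λ a b → reflexive (ℤᵖ.+-comm a b)
        }
      ; *-cong = λ {a} {b} {c} {d} p q → subst (+ n ℤˢ.∣_) (*-lemma a b c d)
          (ℤˢ.∣m∣n⇒∣m+n (ℤˢ.∣n⇒∣m*n a q) (ℤˢ.∣n⇒∣m*n d p))
      ; *-assoc = λ a b c → reflexive (ℤᵖ.*-assoc a b c)
      ; *-identity = (λ a → reflexive (ℤᵖ.*-identityˡ a))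
                   , (λ a → reflexive (ℤᵖ.*-identityʳ a))
      ; distrib = (λ a b c → reflexive (ℤᵖ.*-distribˡ-+ a b c))
                , (λ a b c → reflexive (ℤᵖ.*-distribʳ-+ a b c))
      }
    ; *-comm = λ a b → reflexive (ℤᵖ.*-comm a b)
    }
  }
  where
  reflexive : ∀ {a b} → a ≡ b → a ≡ b [mod n ]
  reflexive {a} refl = ℤˢ.divides ℤ.0ℤ (ℤᵖ.+-inverseʳ a)

  sym-lemma : ∀ a b → ℤ.- (a ℤ.- b) ≡ b ℤ.- a
  sym-lemma = solve-∀

  trans-lemma : ∀ a b c → (a ℤ.- b) ℤ.+ (b ℤ.- c) ≡ a ℤ.- c
  trans-lemma = solve-∀

  +-lemma : ∀ a b c d → (a ℤ.- b) ℤ.+ (c ℤ.- d) ≡ (a ℤ.+ c) ℤ.- (b ℤ.+ d)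
  +-lemma = solve-∀

  neg-lemma : ∀ a b → ℤ.- (a ℤ.- b) ≡ (ℤ.- a) ℤ.- (ℤ.- b)
  neg-lemma = solve-∀

  *-lemma : ∀ a b c d → a ℤ.* (c ℤ.- d) ℤ.+ d ℤ.* (a ℤ.- b) ≡ a ℤ.* c ℤ.- b ℤ.* d
  *-lemma = solve-∀

  sym′ : ∀ {a b} → a ≡ b [mod n ] → b ≡ a [mod n ]
  sym′ {a} {b} p = subst (+ n ℤˢ.∣_) (sym-lemma a b) (ℤˢ.∣m⇒∣-m p)

  trans′ : ∀ {a b c} → a ≡ b [mod n ] → b ≡ c [mod n ] → a ≡ c [mod n ]
  trans′ {a} {b} {c} p q = subst (+ n ℤˢ.∣_) (trans-lemma a b c) (ℤˢ.∣m∣n⇒∣m+n p q)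

⌜_⌝ : ℤ → ℚ
⌜ i ⌝ = i / 1

private
  toℚᵘ-⌜⌝ : ∀ i → ℚ.toℚᵘ ⌜ i ⌝ ℚᵘ.≃ ℚᵘ.mkℚᵘ i 0
  toℚᵘ-⌜⌝ i = ℚᵖ.toℚᵘ-fromℚᵘ (ℚᵘ.mkℚᵘ i 0)

  ⌜⌝-* : ∀ i j → ⌜ i ⌝ ℚ.* ⌜ j ⌝ ≡ ⌜ i ℤ.* j ⌝
  ⌜⌝-* i j = ℚᵖ.toℚᵘ-injective (begin
    ℚ.toℚᵘ (⌜ i ⌝ ℚ.* ⌜ j ⌝)             ≈⟨ ℚᵖ.toℚᵘ-homo-* ⌜ i ⌝ ⌜ j ⌝ ⟩
    ℚ.toℚᵘ ⌜ i ⌝ ℚᵘ.* ℚ.toℚᵘ ⌜ j ⌝      ≈⟨ ℚᵘᵖ.*-cong (toℚᵘ-⌜⌝ i) (toℚᵘ-⌜⌝ j) ⟩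
    ℚᵘ.mkℚᵘ (i ℤ.* j) 0                 ≈⟨ toℚᵘ-⌜⌝ (i ℤ.* j) ⟨
    ℚ.toℚᵘ ⌜ i ℤ.* j ⌝                  ∎)
    where open ℚᵘᵖ.≃-Reasoning

  ⌜⌝-+ : ∀ i j → ⌜ i ⌝ ℚ.+ ⌜ j ⌝ ≡ ⌜ i ℤ.+ j ⌝
  ⌜⌝-+ i j = ℚᵖ.toℚᵘ-injective (begin
    ℚ.toℚᵘ (⌜ i ⌝ ℚ.+ ⌜ j ⌝)             ≈⟨ ℚᵖ.toℚᵘ-homo-+ ⌜ i ⌝ ⌜ j ⌝ ⟩
    ℚ.toℚᵘ ⌜ i ⌝ ℚᵘ.+ ℚ.toℚᵘ ⌜ j ⌝      ≈⟨ ℚᵘᵖ.+-cong (toℚᵘ-⌜⌝ i) (toℚᵘ-⌜⌝ j) ⟩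
    ℚᵘ.mkℚᵘ i 0 ℚᵘ.+ ℚᵘ.mkℚᵘ j 0        ≈⟨ ℚᵘ.*≡* (lemma i j) ⟩
    ℚᵘ.mkℚᵘ (i ℤ.+ j) 0                 ≈⟨ toℚᵘ-⌜⌝ (i ℤ.+ j) ⟨
    ℚ.toℚᵘ ⌜ i ℤ.+ j ⌝                  ∎)
    where
    open ℚᵘᵖ.≃-Reasoning
    lemma : ∀ i j → (i ℤ.* (+ 1) ℤ.+ j ℤ.* (+ 1)) ℤ.* (+ 1) ≡ (i ℤ.+ j) ℤ.* (+ 1)
    lemma = solve-∀

  clear-denominator : ∀ x → x ℚ.* ⌜ ℚ.↧ x ⌝ ≡ ⌜ ℚ.↥ x ⌝
  clear-denominator x@(mkℚ i d _) = ℚᵖ.toℚᵘ-injective (begin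
    ℚ.toℚᵘ (x ℚ.* ⌜ + suc d ⌝)                ≈⟨ ℚᵖ.toℚᵘ-homo-* x ⌜ + suc d ⌝ ⟩
    ℚ.toℚᵘ x ℚᵘ.* ℚ.toℚᵘ ⌜ + suc d ⌝          ≈⟨ ℚᵘᵖ.*-congˡ {ℚ.toℚᵘ x} (toℚᵘ-⌜⌝ (+ suc d)) ⟩
    ℚᵘ.mkℚᵘ i d ℚᵘ.* ℚᵘ.mkℚᵘ (+ suc d) 0      ≈⟨ ℚᵘ.*≡* lemma ⟩
    ℚᵘ.mkℚᵘ i 0                               ≈⟨ toℚᵘ-⌜⌝ i ⟨
    ℚ.toℚᵘ ⌜ i ⌝                              ∎)
    where
    open ℚᵘᵖ.≃-Reasoning
    lemma : (i ℤ.* + suc d) ℤ.* + 1 ≡ i ℤ.* + suc (d ℕ.* 1)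
    lemma = trans (ℤᵖ.*-identityʳ _) (cong (λ e → i ℤ.* + suc e) (sym (ℕᵖ.*-identityʳ d)))

-- A countable neighbourhood basis of 0 for a ring topology on ℚ.
record RingTopology : Set₁ where
  field
    Small       : ℕ → ℚ → Set
    small-0     : ∀ k → Small k ℚ.0ℚ
    small-neg   : ∀ k {x} → Small k x → Small k (ℚ.- x)
    small-mono  : ∀ {j k x} → j ℕ.≤ k → Small k x → Small j x
    small-+     : ∀ k → ∃[ j ] (∀ {x y} → Small j x → Small j y → Small k (x ℚ.+ y))
    small-*     : ∀ k → ∃[ j ] (∀ {x y} → Small j x → Small j y → Small k (x ℚ.* y))
    small-scale : ∀ a k → ∃[ j ] (∀ {x} → Small j x → Small k (a ℚ.* x))

module Completion (T : RingTopology) where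
  open RingTopology T

  IsCauchy : (ℕ → ℚ) → Set
  IsCauchy x = ∀ k → ∃[ N ] (∀ m n → N ℕ.≤ m → N ℕ.≤ n → Small k (x m ℚ.- x n))

  record CauchySequence : Set where
    constructor cauchy
    field
      seq      : ℕ → ℚ
      isCauchy : IsCauchy seq
  open CauchySequence public

  infix 4 _≈_
  _≈_ : CauchySequence → CauchySequence → Set
  x ≈ y = ∀ k → ∃[ N ] (∀ n → N ℕ.≤ n → Small k (seq x n ℚ.- seq y n))

  const : ℚ → CauchySequence
  const q = cauchy (λ _ → q)
    λ k → 0 , λ _ _ _ _ → subst (Small k) (sym (ℚᵖ.+-inverseʳ q)) (small-0 k)

  private
    open +-*-Solver

    pointwise : ∀ {x y} → (∀ n → seq x n ≡ seq y n) → x ≈ y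
    pointwise {x} {y} eq k = 0 , λ n _ →
      subst (Small k) (trans (sym (ℚᵖ.+-inverseʳ (seq x n))) (cong (λ t → seq x n ℚ.- t) (eq n)))
            (small-0 k)

    ⊔-≤ˡ : ∀ {i j n} → i ℕ.⊔ j ℕ.≤ n → i ℕ.≤ n
    ⊔-≤ˡ {i} {j} = ℕᵖ.≤-trans (ℕᵖ.m≤m⊔n i j)

    ⊔-≤ʳ : ∀ {i j n} → i ℕ.⊔ j ℕ.≤ n → j ℕ.≤ n
    ⊔-≤ʳ {i} {j} = ℕᵖ.≤-trans (ℕᵖ.m≤n⊔m i j)

    +-lemma : ∀ a b c d → (a ℚ.- b) ℚ.+ (c ℚ.- d) ≡ (a ℚ.+ c) ℚ.- (b ℚ.+ d)
    +-lemma = solve 4 (λ a b c d → (a :- b) :+ (c :- d) := (a :+ c) :- (b :+ d)) refl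

    neg-lemma : ∀ a b → ℚ.- (a ℚ.- b) ≡ (ℚ.- a) ℚ.- (ℚ.- b)
    neg-lemma = solve 2 (λ a b → :- (a :- b) := (:- a) :- (:- b)) refl

    sym-lemma : ∀ a b → ℚ.- (a ℚ.- b) ≡ b ℚ.- a
    sym-lemma = solve 2 (λ a b → :- (a :- b) := b :- a) refl

    trans-lemma : ∀ a b c → (a ℚ.- b) ℚ.+ (b ℚ.- c) ≡ a ℚ.- c
    trans-lemma = solve 3 (λ a b c → (a :- b) :+ (b :- c) := a :- c) refl

    -- a and d are compared with fixed terms a₀ and d₀ of their sequences.
    *-lemma : ∀ a₀ d₀ a b c d →
      (a₀ ℚ.* (c ℚ.- d) ℚ.+ (a ℚ.- a₀) ℚ.* (c ℚ.- d)) ℚ.+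
      (d₀ ℚ.* (a ℚ.- b) ℚ.+ (d ℚ.- d₀) ℚ.* (a ℚ.- b))
      ≡ a ℚ.* c ℚ.- b ℚ.* d
    *-lemma = solve 6 (λ a₀ d₀ a b c d →
      (a₀ :* (c :- d) :+ (a :- a₀) :* (c :- d)) :+
      (d₀ :* (a :- b) :+ (d :- d₀) :* (a :- b))
      := a :* c :- b :* d) refl

    small-product : ∀ k → ∃[ i ] (∀ a₀ d₀ → ∃[ j ] (∀ {a b c d} →
      Small i (a ℚ.- a₀) → Small i (d ℚ.- d₀) → Small j (a ℚ.- b) → Small j (c ℚ.- d) →
      Small k (a ℚ.* c ℚ.- b ℚ.* d)))
    small-product k with small-+ k
    ... | k₁ , add₁ with small-+ k₁
    ... | k₂ , add₂ with small-* k₂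
    ... | i , mul = i , λ a₀ d₀ →
      let j₁ , scaleA = small-scale a₀ k₂
          j₂ , scaleD = small-scale d₀ k₂
          l₁ = ⊔-≤ˡ {j₁} {j₂} (⊔-≤ˡ {j₁ ℕ.⊔ j₂} {i} ℕᵖ.≤-refl)
          l₂ = ⊔-≤ʳ {j₁} {j₂} (⊔-≤ˡ {j₁ ℕ.⊔ j₂} {i} ℕᵖ.≤-refl)
          l₃ = ⊔-≤ʳ {j₁ ℕ.⊔ j₂} {i} ℕᵖ.≤-refl
      in (j₁ ℕ.⊔ j₂) ℕ.⊔ i , λ {a} {b} {c} {d} a-a₀ d-d₀ a-b c-d →
        subst (Small k) (*-lemma a₀ d₀ a b c d)
          (add₁ (add₂ (scaleA (small-mono l₁ c-d)) (mul a-a₀ (small-mono l₃ c-d)))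
                (add₂ (scaleD (small-mono l₂ a-b)) (mul d-d₀ (small-mono l₃ a-b))))

  infixl 6 _+_
  _+_ : CauchySequence → CauchySequence → CauchySequence
  cauchy x p + cauchy y q = cauchy (λ n → x n ℚ.+ y n) λ k →
    let j , add = small-+ k
        M , f = p j
        N , g = q j
    in M ℕ.⊔ N , λ m n l l′ → subst (Small k) (+-lemma (x m) (x n) (y m) (y n))
         (add (f m n (⊔-≤ˡ l) (⊔-≤ˡ l′)) (g m n (⊔-≤ʳ {M} l) (⊔-≤ʳ {M} l′)))

  infix 8 -_
  -_ : CauchySequence → CauchySequence
  - cauchy x p = cauchy (λ n → ℚ.- x n) λ k →
    let N , f = p k
    in N , λ m n l l′ → subst (Small k) (neg-lemma (x m) (x n)) (small-neg k (f m n l l′))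

  infixl 7 _*_
  _*_ : CauchySequence → CauchySequence → CauchySequence
  cauchy x p * cauchy y q = cauchy (λ n → x n ℚ.* y n) λ k →
    let i , fixed = small-product k
        M , f = p i
        N , g = q i
        j , mul = fixed (x M) (y N)
        M′ , f′ = p j
        N′ , g′ = q j
    in (M ℕ.⊔ N) ℕ.⊔ (M′ ℕ.⊔ N′) , λ m n l l′ →
         mul {x m} {x n} {y m} {y n} (f m M (⊔-≤ˡ (⊔-≤ˡ {M ℕ.⊔ N} l)) ℕᵖ.≤-refl)
             (g n N (⊔-≤ʳ {M} (⊔-≤ˡ {M ℕ.⊔ N} l′)) ℕᵖ.≤-refl)
             (f′ m n (⊔-≤ˡ (⊔-≤ʳ {M ℕ.⊔ N} l)) (⊔-≤ˡ (⊔-≤ʳ {M ℕ.⊔ N} l′)))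
             (g′ m n (⊔-≤ʳ {M′} (⊔-≤ʳ {M ℕ.⊔ N} l)) (⊔-≤ʳ {M′} (⊔-≤ʳ {M ℕ.⊔ N} l′)))

  private
    ≈-sym : ∀ {x y} → x ≈ y → y ≈ x
    ≈-sym {x} {y} p k =
      let N , f = p k
      in N , λ n l → subst (Small k) (sym-lemma (seq x n) (seq y n)) (small-neg k (f n l))

    ≈-trans : ∀ {x y z} → x ≈ y → y ≈ z → x ≈ z
    ≈-trans {x} {y} {z} p q k =
      let j , add = small-+ k
          M , f = p j
          N , g = q j
      in M ℕ.⊔ N , λ n l → subst (Small k) (trans-lemma (seq x n) (seq y n) (seq z n))
           (add (f n (⊔-≤ˡ l)) (g n (⊔-≤ʳ {M} l)))

    +-cong : ∀ {x x′ y y′} → x ≈ x′ → y ≈ y′ → x + y ≈ x′ + y′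
    +-cong {x} {x′} {y} {y′} p q k =
      let j , add = small-+ k
          M , f = p j
          N , g = q j
      in M ℕ.⊔ N , λ n l → subst (Small k) (+-lemma (seq x n) (seq x′ n) (seq y n) (seq y′ n))
           (add (f n (⊔-≤ˡ l)) (g n (⊔-≤ʳ {M} l)))

    neg-cong : ∀ {x y} → x ≈ y → - x ≈ - y
    neg-cong {x} {y} p k =
      let N , f = p k
      in N , λ n l → subst (Small k) (neg-lemma (seq x n) (seq y n)) (small-neg k (f n l))

    *-cong : ∀ {x x′ y y′} → x ≈ x′ → y ≈ y′ → x * y ≈ x′ * y′
    *-cong {x} {x′} {y} {y′} p q k =
      let i , fixed = small-product k
          M , f = isCauchy x i
          N , g = isCauchy y′ i
          j , mul = fixed (seq x M) (seq y′ N)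
          M′ , f′ = p j
          N′ , g′ = q j
      in (M ℕ.⊔ N) ℕ.⊔ (M′ ℕ.⊔ N′) , λ n l →
           mul {seq x n} {seq x′ n} {seq y n} {seq y′ n} (f n M (⊔-≤ˡ (⊔-≤ˡ {M ℕ.⊔ N} l)) ℕᵖ.≤-refl)
               (g n N (⊔-≤ʳ {M} (⊔-≤ˡ {M ℕ.⊔ N} l)) ℕᵖ.≤-refl)
               (f′ n (⊔-≤ˡ (⊔-≤ʳ {M ℕ.⊔ N} l)))
               (g′ n (⊔-≤ʳ {M′} (⊔-≤ʳ {M ℕ.⊔ N} l)))

  commutativeRing : Ring
  commutativeRing = record
    { Carrier = CauchySequence
    ; _≈_     = _≈_
    ; _+_     = _+_
    ; _*_     = _*_
    ; -_      = -_
    ; 0#      = const ℚ.0ℚ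
    ; 1#      = const ℚ.1ℚ
    ; isCommutativeRing = record
      { isRing = record
        { +-isAbelianGroup = record
          { isGroup = record
            { isMonoid = record
              { isSemigroup = record
                { isMagma = record
                  { isEquivalence = record
                    { refl  = λ {x} → pointwise {x} {x} λ _ → refl
                    ; sym   = λ {x} {y} → ≈-sym {x} {y}
                    ; trans = λ {x} {y} {z} → ≈-trans {x} {y} {z}
                    }
                  ; ∙-cong = λ {x} {x′} {y} {y′} → +-cong {x} {x′} {y} {y′}
                  }
                ; assoc = λ x y z → pointwise {(x + y) + z} {x + (y + z)}
                    λ n → ℚᵖ.+-assoc (seq x n) (seq y n) (seq z n)
                }
              ; identity = (λ x → pointwise {const ℚ.0ℚ + x} {x} λ n → ℚᵖ.+-identityˡ (seq x n))
                         , (λ x → pointwise {x + const ℚ.0ℚ} {x} λ n → ℚᵖ.+-identityʳ (seq x n))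
              }
            ; inverse = (λ x → pointwise { - x + x} {const ℚ.0ℚ} λ n → ℚᵖ.+-inverseˡ (seq x n))
                      , (λ x → pointwise {x + - x} {const ℚ.0ℚ} λ n → ℚᵖ.+-inverseʳ (seq x n))
            ; ⁻¹-cong = λ {x} {y} → neg-cong {x} {y}
            }
          ; comm = λ x y → pointwise {x + y} {y + x} λ n → ℚᵖ.+-comm (seq x n) (seq y n)
          }
        ; *-cong = λ {x} {x′} {y} {y′} → *-cong {x} {x′} {y} {y′}
        ; *-assoc = λ x y z → pointwise {(x * y) * z} {x * (y * z)}
            λ n → ℚᵖ.*-assoc (seq x n) (seq y n) (seq z n)
        ; *-identity = (λ x → pointwise {const ℚ.1ℚ * x} {x} λ n → ℚᵖ.*-identityˡ (seq x n))
                     , (λ x → pointwise {x * const ℚ.1ℚ} {x} λ n → ℚᵖ.*-identityʳ (seq x n))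
        ; distrib =
            (λ x y z → pointwise {x * (y + z)} {x * y + x * z}
               λ n → ℚᵖ.*-distribˡ-+ (seq x n) (seq y n) (seq z n))
          , (λ x y z → pointwise {(y + z) * x} {y * x + z * x}
               λ n → ℚᵖ.*-distribʳ-+ (seq x n) (seq y n) (seq z n))
        }
      ; *-comm = λ x y → pointwise {x * y} {y * x} λ n → ℚᵖ.*-comm (seq x n) (seq y n)
      }
    }

-- The usual topology: Small k x means ∣x∣ ≤ 1/(k+1).
archimedean : RingTopology
archimedean = record
  { Small       = Small
  ; small-0     = λ k → ℚᵖ.nonNegative⁻¹ (inv k) {{inv-nonNeg k}}
  ; small-neg   = λ k {x} p → subst (ℚ._≤ inv k) (sym (ℚᵖ.∣-p∣≡∣p∣ x)) p
  ; small-mono  = λ j≤k p → ℚᵖ.≤-trans p (inv-mono j≤k)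
  ; small-+     = λ k → k ℕ.+ suc k , λ {x} {y} p q →
      ℚᵖ.≤-trans (ℚᵖ.∣p+q∣≤∣p∣+∣q∣ x y)
        (ℚᵖ.≤-trans (ℚᵖ.+-mono-≤ p q) (ℚᵖ.≤-reflexive (half k)))
  ; small-*     = λ k → k , λ {x} {y} p q → mul k x y p q
  ; small-scale = λ a k → scaleIndex a k , λ {x} p → scale a k x p
  }
  where
  inv : ℕ → ℚ
  inv k = + 1 / suc k

  Small : ℕ → ℚ → Set
  Small k x = ℚ.∣ x ∣ ℚ.≤ inv k

  toℚᵘ-inv : ∀ k → ℚ.toℚᵘ (inv k) ℚᵘ.≃ ℚᵘ.mkℚᵘ (+ 1) k
  toℚᵘ-inv k = ℚᵖ.toℚᵘ-fromℚᵘ (ℚᵘ.mkℚᵘ (+ 1) k)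

  inv-nonNeg : ∀ k → ℚ.NonNegative (inv k)
  inv-nonNeg k = ℚᵖ.normalize-nonNeg 1 (suc k)

  inv-mono : ∀ {j k} → j ℕ.≤ k → inv k ℚ.≤ inv j
  inv-mono {j} {k} j≤k = ℚᵖ.toℚᵘ-cancel-≤
    (ℚᵘᵖ.≤-respˡ-≃ (ℚᵘᵖ.≃-sym (toℚᵘ-inv k)) (ℚᵘᵖ.≤-respʳ-≃ (ℚᵘᵖ.≃-sym (toℚᵘ-inv j))
      (ℚᵘ.*≤* (ℤᵖ.*-monoˡ-≤-nonNeg (+ 1) (ℤ.+≤+ (ℕ.s≤s j≤k))))))

  half : ∀ k → inv (k ℕ.+ suc k) ℚ.+ inv (k ℕ.+ suc k) ≡ inv k
  half k = ℚᵖ.toℚᵘ-injective (begin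
    ℚ.toℚᵘ (inv K ℚ.+ inv K)                  ≈⟨ ℚᵖ.toℚᵘ-homo-+ (inv K) (inv K) ⟩
    ℚ.toℚᵘ (inv K) ℚᵘ.+ ℚ.toℚᵘ (inv K)        ≈⟨ ℚᵘᵖ.+-cong (toℚᵘ-inv K) (toℚᵘ-inv K) ⟩
    ℚᵘ.mkℚᵘ (+ 1) K ℚᵘ.+ ℚᵘ.mkℚᵘ (+ 1) K      ≈⟨ ℚᵘ.*≡* lemma′ ⟩
    ℚᵘ.mkℚᵘ (+ 1) k                           ≈⟨ toℚᵘ-inv k ⟨
    ℚ.toℚᵘ (inv k)                            ∎)
    where
    open ℚᵘᵖ.≃-Reasoning
    K = k ℕ.+ suc k
    lemma : ∀ s → (+ 1 ℤ.* (s ℤ.+ s) ℤ.+ + 1 ℤ.* (s ℤ.+ s)) ℤ.* s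
                ≡ + 1 ℤ.* ((s ℤ.+ s) ℤ.* (s ℤ.+ s))
    lemma = solve-∀
    lemma′ : (+ 1 ℤ.* + suc K ℤ.+ + 1 ℤ.* + suc K) ℤ.* + suc k ≡ + 1 ℤ.* + (suc K ℕ.* suc K)
    lemma′ = trans (lemma (+ suc k)) (cong (+ 1 ℤ.*_) (sym (ℤᵖ.pos-* (suc K) (suc K))))

  inv-* : ∀ j k → inv j ℚ.* inv k ≡ inv (k ℕ.+ j ℕ.* suc k)
  inv-* j k = ℚᵖ.toℚᵘ-injective (begin
    ℚ.toℚᵘ (inv j ℚ.* inv k)                  ≈⟨ ℚᵖ.toℚᵘ-homo-* (inv j) (inv k) ⟩
    ℚ.toℚᵘ (inv j) ℚᵘ.* ℚ.toℚᵘ (inv k)        ≈⟨ ℚᵘᵖ.*-cong (toℚᵘ-inv j) (toℚᵘ-inv k) ⟩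
    ℚᵘ.mkℚᵘ (+ 1) (k ℕ.+ j ℕ.* suc k)         ≈⟨ toℚᵘ-inv (k ℕ.+ j ℕ.* suc k) ⟨
    ℚ.toℚᵘ (inv (k ℕ.+ j ℕ.* suc k))          ∎)
    where open ℚᵘᵖ.≃-Reasoning

  abs-mono : ∀ {x y a b} → ℚ.∣ x ∣ ℚ.≤ a → ℚ.∣ y ∣ ℚ.≤ b → .{{ℚ.NonNegative a}} →
             ℚ.∣ x ℚ.* y ∣ ℚ.≤ a ℚ.* b
  abs-mono {x} {y} {a} {b} p q = ℚᵖ.≤-trans (ℚᵖ.≤-reflexive (ℚᵖ.∣p*q∣≡∣p∣*∣q∣ x y))
    (ℚᵖ.≤-trans (ℚᵖ.*-monoʳ-≤-nonNeg ℚ.∣ y ∣ {{ℚᵖ.∣-∣-nonNeg y}} p)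
                (ℚᵖ.*-monoˡ-≤-nonNeg a q))

  mul : ∀ k x y → Small k x → Small k y → Small k (x ℚ.* y)
  mul k x y p q = ℚᵖ.≤-trans (abs-mono {x} {y} p q {{inv-nonNeg k}})
    (ℚᵖ.≤-trans (ℚᵖ.≤-reflexive (inv-* k k)) (inv-mono (ℕᵖ.m≤m+n k (k ℕ.* suc k))))

  scaleIndex : ℚ → ℕ → ℕ
  scaleIndex a k = k ℕ.+ ℤ.∣ ℚ.↥ a ∣ ℕ.* suc k

  scale : ∀ a k x → Small (scaleIndex a k) x → Small k (a ℚ.* x)
  scale a@(mkℚ i d _) k x p =
    ℚᵖ.≤-trans (ℚᵖ.≤-reflexive (cong ℚ.∣_∣ (ℚᵖ.*-comm a x)))
    (ℚᵖ.≤-trans (abs-mono {x} {a} p ∣a∣≤ {{inv-nonNeg (scaleIndex a k)}})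
      (ℚᵖ.≤-reflexive cancel))
    where
    M = ℤ.∣ i ∣

    ∣a∣≤ : ℚ.∣ a ∣ ℚ.≤ ⌜ + suc M ⌝
    ∣a∣≤ = ℚᵖ.toℚᵘ-cancel-≤ (ℚᵘᵖ.≤-respˡ-≃ (ℚᵘᵖ.≃-sym (ℚᵖ.toℚᵘ-homo-∣-∣ a))
      (ℚᵘᵖ.≤-respʳ-≃ (ℚᵘᵖ.≃-sym (toℚᵘ-⌜⌝ (+ suc M))) (ℚᵘ.*≤* lemma)))
      where
      lemma : + M ℤ.* + 1 ℤ.≤ + suc M ℤ.* + suc d
      lemma = subst (ℤ._≤ + suc M ℤ.* + suc d) (sym (ℤᵖ.*-identityʳ (+ M)))
        (ℤ.+≤+ (ℕᵖ.≤-trans (ℕᵖ.n≤1+n M) (ℕᵖ.m≤m*n (suc M) (suc d))))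

    cancel : inv (scaleIndex a k) ℚ.* ⌜ + suc M ⌝ ≡ inv k
    cancel = ℚᵖ.toℚᵘ-injective (begin
      ℚ.toℚᵘ (inv J ℚ.* ⌜ + suc M ⌝)              ≈⟨ ℚᵖ.toℚᵘ-homo-* (inv J) ⌜ + suc M ⌝ ⟩
      ℚ.toℚᵘ (inv J) ℚᵘ.* ℚ.toℚᵘ ⌜ + suc M ⌝      ≈⟨ ℚᵘᵖ.*-cong (toℚᵘ-inv J) (toℚᵘ-⌜⌝ (+ suc M)) ⟩
      ℚᵘ.mkℚᵘ (+ 1) J ℚᵘ.* ℚᵘ.mkℚᵘ (+ suc M) 0    ≈⟨ ℚᵘ.*≡* lemma′ ⟩
      ℚᵘ.mkℚᵘ (+ 1) k                             ≈⟨ toℚᵘ-inv k ⟨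
      ℚ.toℚᵘ (inv k)                              ∎)
      where
      open ℚᵘᵖ.≃-Reasoning
      J = scaleIndex a k
      lemma : ∀ m s → (+ 1 ℤ.* m) ℤ.* s ≡ + 1 ℤ.* ((m ℤ.* s) ℤ.* + 1)
      lemma = solve-∀
      lemma′ : (+ 1 ℤ.* + suc M) ℤ.* + suc k ≡ + 1 ℤ.* + (suc J ℕ.* 1)
      lemma′ = trans (lemma (+ suc M) (+ suc k)) (cong (+ 1 ℤ.*_)
        (trans (cong (ℤ._* + 1) (sym (ℤᵖ.pos-* (suc M) (suc k)))) (sym (ℤᵖ.pos-* (suc J) 1))))

-- The ℓ-adic topology: Small k x means x ∈ ℓᵏ ℤ₍ℓ₎, i.e. x = ℓᵏ a / b with
-- ℓ ∤ b, i.e. ∣x∣_ℓ ≤ ℓ⁻ᵏ.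
adic : (ℓ : ℕ) → Prime ℓ → RingTopology
adic ℓ ℓ-prime = record
  { Small       = Small
  ; small-0     = λ k → ℤ.0ℤ , + 1 , 1-unit , cong ⌜_⌝ (sym (ℤᵖ.*-zeroʳ (+ (ℓ ℕ.^ k))))
  ; small-neg   = λ { k {x} (a , b , u , eq) → ℤ.- a , b , u , (begin
      (ℚ.- x) ℚ.* ⌜ b ⌝                         ≡⟨ neg-lemma x ⌜ b ⌝ ⟩
      x ℚ.* ⌜ b ⌝ ℚ.* ⌜ ℤ.- + 1 ⌝               ≡⟨ cong (ℚ._* ⌜ ℤ.- + 1 ⌝) eq ⟩
      ⌜ + (ℓ ℕ.^ k) ℤ.* a ⌝ ℚ.* ⌜ ℤ.- + 1 ⌝     ≡⟨ ⌜⌝-* (+ (ℓ ℕ.^ k) ℤ.* a) (ℤ.- + 1) ⟩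
      ⌜ + (ℓ ℕ.^ k) ℤ.* a ℤ.* ℤ.- + 1 ⌝         ≡⟨ cong ⌜_⌝ (neg-lemmaᶻ (+ (ℓ ℕ.^ k)) a) ⟩
      ⌜ + (ℓ ℕ.^ k) ℤ.* ℤ.- a ⌝                 ∎) }
  ; small-mono  = λ { {j} {k} {x} j≤k (a , b , u , eq) →
      + (ℓ ℕ.^ (k ℕ.∸ j)) ℤ.* a , b , u , trans eq (cong ⌜_⌝ (begin
        + (ℓ ℕ.^ k) ℤ.* a
          ≡⟨ cong (λ e → + (ℓ ℕ.^ e) ℤ.* a) (ℕᵖ.m+[n∸m]≡n j≤k) ⟨
        + (ℓ ℕ.^ (j ℕ.+ (k ℕ.∸ j))) ℤ.* a
          ≡⟨ cong (ℤ._* a) (pow-+ j (k ℕ.∸ j)) ⟩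
        + (ℓ ℕ.^ j) ℤ.* + (ℓ ℕ.^ (k ℕ.∸ j)) ℤ.* a
          ≡⟨ ℤᵖ.*-assoc (+ (ℓ ℕ.^ j)) (+ (ℓ ℕ.^ (k ℕ.∸ j))) a ⟩
        + (ℓ ℕ.^ j) ℤ.* (+ (ℓ ℕ.^ (k ℕ.∸ j)) ℤ.* a) ∎)) }
  ; small-+     = λ k → k , λ { {x} {y} (a , b , u , eq) (a′ , b′ , u′ , eq′) →
      a ℤ.* b′ ℤ.+ a′ ℤ.* b , b ℤ.* b′ , unit-* {b} {b′} u u′ , (begin
        (x ℚ.+ y) ℚ.* ⌜ b ℤ.* b′ ⌝
          ≡⟨ cong ((x ℚ.+ y) ℚ.*_) (⌜⌝-* b b′) ⟨
        (x ℚ.+ y) ℚ.* (⌜ b ⌝ ℚ.* ⌜ b′ ⌝)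
          ≡⟨ +-lemma x y ⌜ b ⌝ ⌜ b′ ⌝ ⟩
        x ℚ.* ⌜ b ⌝ ℚ.* ⌜ b′ ⌝ ℚ.+ y ℚ.* ⌜ b′ ⌝ ℚ.* ⌜ b ⌝
          ≡⟨ cong₂ (λ s t → s ℚ.* ⌜ b′ ⌝ ℚ.+ t ℚ.* ⌜ b ⌝) eq eq′ ⟩
        ⌜ L k ℤ.* a ⌝ ℚ.* ⌜ b′ ⌝ ℚ.+ ⌜ L k ℤ.* a′ ⌝ ℚ.* ⌜ b ⌝
          ≡⟨ cong₂ ℚ._+_ (⌜⌝-* (L k ℤ.* a) b′) (⌜⌝-* (L k ℤ.* a′) b) ⟩
        ⌜ L k ℤ.* a ℤ.* b′ ⌝ ℚ.+ ⌜ L k ℤ.* a′ ℤ.* b ⌝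
          ≡⟨ ⌜⌝-+ (L k ℤ.* a ℤ.* b′) (L k ℤ.* a′ ℤ.* b) ⟩
        ⌜ L k ℤ.* a ℤ.* b′ ℤ.+ L k ℤ.* a′ ℤ.* b ⌝
          ≡⟨ cong ⌜_⌝ (+-lemmaᶻ (L k) a a′ b b′) ⟩
        ⌜ L k ℤ.* (a ℤ.* b′ ℤ.+ a′ ℤ.* b) ⌝ ∎) }
  ; small-*     = λ k → k , λ { {x} {y} (a , b , u , eq) (a′ , b′ , u′ , eq′) →
      a ℤ.* (L k ℤ.* a′) , b ℤ.* b′ , unit-* {b} {b′} u u′ , (begin
        x ℚ.* y ℚ.* ⌜ b ℤ.* b′ ⌝
          ≡⟨ cong (x ℚ.* y ℚ.*_) (⌜⌝-* b b′) ⟨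
        x ℚ.* y ℚ.* (⌜ b ⌝ ℚ.* ⌜ b′ ⌝)
          ≡⟨ *-lemma x y ⌜ b ⌝ ⌜ b′ ⌝ ⟩
        x ℚ.* ⌜ b ⌝ ℚ.* (y ℚ.* ⌜ b′ ⌝)
          ≡⟨ cong₂ ℚ._*_ eq eq′ ⟩
        ⌜ L k ℤ.* a ⌝ ℚ.* ⌜ L k ℤ.* a′ ⌝
          ≡⟨ ⌜⌝-* (L k ℤ.* a) (L k ℤ.* a′) ⟩
        ⌜ L k ℤ.* a ℤ.* (L k ℤ.* a′) ⌝
          ≡⟨ cong ⌜_⌝ (ℤᵖ.*-assoc (L k) a (L k ℤ.* a′)) ⟩
        ⌜ L k ℤ.* (a ℤ.* (L k ℤ.* a′)) ⌝ ∎) }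
  ; small-scale = λ c k →
      let s , q , u , split = unit-part (ℚ.↧ₙ c)
      in k ℕ.+ s , λ { {x} (a , b , v , eq) →
      ℚ.↥ c ℤ.* a , + q ℤ.* b , unit-* {+ q} {b} u v , (begin
        c ℚ.* x ℚ.* ⌜ + q ℤ.* b ⌝
          ≡⟨ cong (c ℚ.* x ℚ.*_) (⌜⌝-* (+ q) b) ⟨
        c ℚ.* x ℚ.* (⌜ + q ⌝ ℚ.* ⌜ b ⌝)
          ≡⟨ scale-lemma c x ⌜ + q ⌝ ⌜ b ⌝ ⟩
        c ℚ.* (⌜ + q ⌝ ℚ.* (x ℚ.* ⌜ b ⌝))
          ≡⟨ cong (λ t → c ℚ.* (⌜ + q ⌝ ℚ.* t)) eq ⟩
        c ℚ.* (⌜ + q ⌝ ℚ.* ⌜ L (k ℕ.+ s) ℤ.* a ⌝)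
          ≡⟨ cong (c ℚ.*_) (⌜⌝-* (+ q) (L (k ℕ.+ s) ℤ.* a)) ⟩
        c ℚ.* ⌜ + q ℤ.* (L (k ℕ.+ s) ℤ.* a) ⌝
          ≡⟨ cong (λ t → c ℚ.* ⌜ + q ℤ.* (t ℤ.* a) ⌝) (pow-+ k s) ⟩
        c ℚ.* ⌜ + q ℤ.* (L k ℤ.* L s ℤ.* a) ⌝
          ≡⟨ cong (λ t → c ℚ.* ⌜ t ⌝) (scale-lemmaᶻ (+ q) (L k) (L s) a) ⟩
        c ℚ.* ⌜ L s ℤ.* + q ℤ.* (L k ℤ.* a) ⌝
          ≡⟨ cong (λ t → c ℚ.* ⌜ t ℤ.* (L k ℤ.* a) ⌝) (trans (sym (ℤᵖ.pos-* (ℓ ℕ.^ s) q)) (cong +_ (sym split))) ⟩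
        c ℚ.* ⌜ ℚ.↧ c ℤ.* (L k ℤ.* a) ⌝
          ≡⟨ cong (c ℚ.*_) (⌜⌝-* (ℚ.↧ c) (L k ℤ.* a)) ⟨
        c ℚ.* (⌜ ℚ.↧ c ⌝ ℚ.* ⌜ L k ℤ.* a ⌝)
          ≡⟨ ℚᵖ.*-assoc c ⌜ ℚ.↧ c ⌝ ⌜ L k ℤ.* a ⌝ ⟨
        c ℚ.* ⌜ ℚ.↧ c ⌝ ℚ.* ⌜ L k ℤ.* a ⌝
          ≡⟨ cong (ℚ._* ⌜ L k ℤ.* a ⌝) (clear-denominator c) ⟩
        ⌜ ℚ.↥ c ⌝ ℚ.* ⌜ L k ℤ.* a ⌝
          ≡⟨ ⌜⌝-* (ℚ.↥ c) (L k ℤ.* a) ⟩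
        ⌜ ℚ.↥ c ℤ.* (L k ℤ.* a) ⌝
          ≡⟨ cong ⌜_⌝ (swap-lemmaᶻ (ℚ.↥ c) (L k) a) ⟩
        ⌜ L k ℤ.* (ℚ.↥ c ℤ.* a) ⌝ ∎) }
  }
  where
  open ≡-Reasoning
  open +-*-Solver

  L : ℕ → ℤ
  L k = + (ℓ ℕ.^ k)

  Small : ℕ → ℚ → Set
  Small k x = ∃[ a ] ∃[ b ] ¬ + ℓ ℤᵈ.∣ b × x ℚ.* ⌜ b ⌝ ≡ ⌜ + (ℓ ℕ.^ k) ℤ.* a ⌝

  1-unit : ¬ ℓ ℕᵈ.∣ 1
  1-unit ℓ∣1 = Prime.¬prime[1] (subst Prime (ℕᵈ.∣1⇒≡1 ℓ∣1) ℓ-prime)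

  unit-* : ∀ {b b′} → ¬ + ℓ ℤᵈ.∣ b → ¬ + ℓ ℤᵈ.∣ b′ → ¬ + ℓ ℤᵈ.∣ b ℤ.* b′
  unit-* {b} {b′} u u′ div =
    [ u , u′ ]′ (Prime.euclidsLemma ℤ.∣ b ∣ ℤ.∣ b′ ∣ ℓ-prime (subst (ℓ ℕᵈ.∣_) (ℤᵖ.abs-* b b′) div))

  pow-+ : ∀ j k → L (j ℕ.+ k) ≡ L j ℤ.* L k
  pow-+ j k = trans (cong +_ (ℕᵖ.^-distribˡ-+-* ℓ j k)) (ℤᵖ.pos-* (ℓ ℕ.^ j) (ℓ ℕ.^ k))

  unit-part : ∀ n .{{_ : ℕ.NonZero n}} → ∃[ s ] ∃[ q ] ¬ ℓ ℕᵈ.∣ q × n ≡ ℓ ℕ.^ s ℕ.* q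
  unit-part n = go n (ℕᵢ.<-wellFounded n)
    where
    go : ∀ n .{{_ : ℕ.NonZero n}} → Acc ℕ._<_ n → ∃[ s ] ∃[ q ] ¬ ℓ ℕᵈ.∣ q × n ≡ ℓ ℕ.^ s ℕ.* q
    go n (acc rec) with ℓ ℕᵈ.∣? n
    ... | no  ℓ∤n = 0 , n , ℓ∤n , sym (ℕᵖ.*-identityˡ n)
    ... | yes ℓ∣n =
      let instance
            ℓ-nonTrivial = Prime.prime⇒nonTrivial ℓ-prime
            m≢0 = ℕᵈ.quotient≢0 ℓ∣n
          s , q , u , eq = go (ℕᵈ.quotient ℓ∣n) (rec (ℕᵈ.quotient-< ℓ∣n))
      in suc s , q , u , trans (ℕᵈ._∣_.equality ℓ∣n)
           (trans (cong (ℕ._* ℓ) eq) (trans (ℕᵖ.*-comm (ℓ ℕ.^ s ℕ.* q) ℓ)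
             (sym (ℕᵖ.*-assoc ℓ (ℓ ℕ.^ s) q))))

  neg-lemma : ∀ x b → (ℚ.- x) ℚ.* b ≡ x ℚ.* b ℚ.* ⌜ ℤ.- + 1 ⌝
  neg-lemma = solve 2 (λ x b → (:- x) :* b := x :* b :* con ⌜ ℤ.- + 1 ⌝) refl

  neg-lemmaᶻ : ∀ l a → l ℤ.* a ℤ.* ℤ.- + 1 ≡ l ℤ.* ℤ.- a
  neg-lemmaᶻ = solve-∀

  +-lemma : ∀ x y b b′ → (x ℚ.+ y) ℚ.* (b ℚ.* b′) ≡ x ℚ.* b ℚ.* b′ ℚ.+ y ℚ.* b′ ℚ.* b
  +-lemma = solve 4 (λ x y b b′ → (x :+ y) :* (b :* b′) := x :* b :* b′ :+ y :* b′ :* b) refl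

  +-lemmaᶻ : ∀ l a a′ b b′ → l ℤ.* a ℤ.* b′ ℤ.+ l ℤ.* a′ ℤ.* b ≡ l ℤ.* (a ℤ.* b′ ℤ.+ a′ ℤ.* b)
  +-lemmaᶻ = solve-∀

  *-lemma : ∀ x y b b′ → x ℚ.* y ℚ.* (b ℚ.* b′) ≡ x ℚ.* b ℚ.* (y ℚ.* b′)
  *-lemma = solve 4 (λ x y b b′ → x :* y :* (b :* b′) := x :* b :* (y :* b′)) refl

  scale-lemma : ∀ c x q b → c ℚ.* x ℚ.* (q ℚ.* b) ≡ c ℚ.* (q ℚ.* (x ℚ.* b))
  scale-lemma = solve 4 (λ c x q b → c :* x :* (q :* b) := c :* (q :* (x :* b))) refl

  scale-lemmaᶻ : ∀ q l s a → q ℤ.* (l ℤ.* s ℤ.* a) ≡ s ℤ.* q ℤ.* (l ℤ.* a)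
  scale-lemmaᶻ = solve-∀

  swap-lemmaᶻ : ∀ c l a → c ℤ.* (l ℤ.* a) ≡ l ℤ.* (c ℤ.* a)
  swap-lemmaᶻ = solve-∀

data Place : Set where
  ∞      : Place
  finite : (ℓ : ℕ) → Prime ℓ → Place

topology : Place → RingTopology
topology ∞            = archimedean
topology (finite ℓ p) = adic ℓ p

ℚ[_] : Place → Ring
ℚ[ v ] = Completion.commutativeRing (topology v)

embed : ∀ v → ℤ → CommutativeRing.Carrier ℚ[ v ]
embed v i = Completion.const (topology v) ⌜ i ⌝

ℤ[X] : Set
ℤ[X] = Univariate.Poly ℤᵖ.+-*-commutativeRing

HasDegree : ℤ[X] → ℕ → Set
HasDegree = Univariate.HasDegree ℤᵖ.+-*-commutativeRing

IsSeparable : ℤ[X] → Set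
IsSeparable f = Univariate.Separable ℚᵖ.+-*-commutativeRing (List.map ⌜_⌝ f)

-- g is the genus of the smooth projective model of y² = f(x), deg f = n.
IsHyperellipticGenus : ℕ → ℕ → Set
IsHyperellipticGenus n g = n ≡ 2 ℕ.* g ℕ.+ 1 ⊎ n ≡ 2 ℕ.* g ℕ.+ 2

-- Reduction modulo ℓ leaves the list of coefficients unchanged, since the
-- elements of ℤ/ ℓ are integers.
IsGood : ℤ[X] → ℕ → Set
IsGood f ℓ = Prime ℓ × ℓ ≢ 2 × ∃[ n ] HasDegree f n ×
  Univariate.HasDegree (ℤ/ ℓ) f n ×
  (∃[ D ] Univariate.IsDiscriminant (ℤ/ ℓ) f n D × ¬ D ≡ ℤ.0ℤ [mod ℓ ])

IsSquarefree : ℤ → Set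
IsSquarefree d = d ≢ ℤ.0ℤ × (∀ k → k ℤ.* k ℤᵈ.∣ d → ℤ.∣ k ∣ ≡ 1)

HasNontrivialPoint : ℤ[X] → ℤ → Place → Set
HasNontrivialPoint f d v =
  ∃[ x ] ∃[ y ] embed v d * (y * y) ≈ fᵥ x × ¬ fᵥ x ≈ 0#
  where
  open CommutativeRing ℚ[ v ]
  fᵥ : Carrier → Carrier
  fᵥ = Univariate.eval ℚ[ v ] (List.map (embed v) f)

InfinitelyMany : (ℤ → Set) → Set
InfinitelyMany P = ∀ (ds : List ℤ) → ∃[ d ] d ∉ ds × P d

module Submission where

-- A hyperelliptic curve of odd degree has a smooth rational point at infinity,
-- and so has each of its quadratic twists C_d.  Over a completion of ℚ the
-- points of C_d close to it are nontrivial, so C_d has nontrivial local points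
-- everywhere for every d ≠ 0.  It remains to find infinitely many squarefree
-- integers in a residue class prime to p, which is possible because
-- Σ 1/q² over q ≥ 2 is less than 1.

open import Defs
open import Algebra.Bundles using (CommutativeRing)
open import Data.Integer.Base as ℤ using (ℤ; +_)
open import Data.Integer.Coprimality using (Coprime)
import Data.Integer.DivMod as ℤᵐ
import Data.Integer.Divisibility as ℤᵈ
import Data.Integer.Divisibility.Signed as ℤˢ
import Data.Integer.Properties as ℤᵖ
import Data.Integer.Tactic.RingSolver as ℤ-Solver
open import Data.List.Base as List using ([]; _∷_)
open import Data.List.Membership.Propositional using (_∈_)
open import Data.List.Relation.Unary.Any using (here; there)
open import Data.Nat.Base as ℕ using (ℕ; zero; suc; z≤n; s≤s)
import Data.Nat.Coprimality as Coprimality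
open import Data.Nat.Divisibility as ℕᵈ using (_∤_)
import Data.Nat.DivMod as ℕᵐ
open import Data.Nat.ListAction using (sum)
open import Data.Nat.Primality as Prime using (Prime)
import Data.Nat.Properties as ℕᵖ
import Data.Nat.Tactic.RingSolver as ℕ-Solver
open import Data.Product.Base using (∃-syntax; _×_; _,_; proj₁; proj₂)
open import Data.Rational.Base as ℚ using (ℚ; 0ℚ; 1ℚ)
import Data.Rational.Properties as ℚᵖ
open import Data.Rational.Solver using (module +-*-Solver)
import Data.Rational.Unnormalised.Base as ℚᵘ
import Data.Rational.Unnormalised.Properties as ℚᵘᵖ
open import Data.Sum.Base using (_⊎_; inj₁; inj₂; [_,_]′)
open import Relation.Binary.PropositionalEquality
  using (_≡_; _≢_; refl; sym; trans; cong; cong₂; subst; module ≡-Reasoning)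
open import Relation.Nullary using (¬_; Dec; yes; no; contradiction)
open import Relation.Nullary.Decidable using (toWitnessFalse)
open import Relation.Unary using (Decidable)

-- Local points

module _ where
  open import Data.Rational.Base using (_+_; _*_; _-_; -_)
  open +-*-Solver using (solve; con; _:=_; _:+_; _:*_; _:-_; :-_)

  ⌜⌝-injective : ∀ {i j} → ⌜ i ⌝ ≡ ⌜ j ⌝ → i ≡ j
  ⌜⌝-injective {i} {j} eq with ℚᵖ./-injective-≃ (ℚᵘ.mkℚᵘ i 0) (ℚᵘ.mkℚᵘ j 0) eq
  ... | ℚᵘ.*≡* eq′ = trans (sym (ℤᵖ.*-identityʳ i)) (trans eq′ (ℤᵖ.*-identityʳ j))

  ⌜⌝-* : ∀ i j → ⌜ i ⌝ * ⌜ j ⌝ ≡ ⌜ i ℤ.* j ⌝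
  ⌜⌝-* i j = ℚᵖ.toℚᵘ-injective (begin
    ℚ.toℚᵘ (⌜ i ⌝ * ⌜ j ⌝)             ≈⟨ ℚᵖ.toℚᵘ-homo-* ⌜ i ⌝ ⌜ j ⌝ ⟩
    ℚ.toℚᵘ ⌜ i ⌝ ℚᵘ.* ℚ.toℚᵘ ⌜ j ⌝     ≈⟨ ℚᵘᵖ.*-cong (toℚᵘ-⌜⌝ i) (toℚᵘ-⌜⌝ j) ⟩
    ℚᵘ.mkℚᵘ (i ℤ.* j) 0                ≈⟨ toℚᵘ-⌜⌝ (i ℤ.* j) ⟨
    ℚ.toℚᵘ ⌜ i ℤ.* j ⌝                 ∎)
    where
    open ℚᵘᵖ.≃-Reasoning
    toℚᵘ-⌜⌝ : ∀ i → ℚ.toℚᵘ ⌜ i ⌝ ℚᵘ.≃ ℚᵘ.mkℚᵘ i 0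
    toℚᵘ-⌜⌝ i = ℚᵖ.toℚᵘ-fromℚᵘ (ℚᵘ.mkℚᵘ i 0)

  inverse : ∀ {q} → q ≢ 0ℚ → ∃[ q′ ] q * q′ ≡ 1ℚ
  inverse {q} q≢0 = ℚ.1/ q , ℚᵖ.*-inverseʳ q
    where instance _ = ℚ.≢-nonZero q≢0

  *-≢0 : ∀ {p q} → p ≢ 0ℚ → q ≢ 0ℚ → p * q ≢ 0ℚ
  *-≢0 {p} {q} p≢0 q≢0 pq≡0 =
    let p′ , pp′≡1 = inverse p≢0
    in q≢0 (begin
      q               ≡⟨ ℚᵖ.*-identityˡ q ⟨
      1ℚ * q          ≡⟨ cong (_* q) pp′≡1 ⟨
      p * p′ * q      ≡⟨ solve 3 (λ p p′ q → p :* p′ :* q := p′ :* (p :* q)) refl p p′ q ⟩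
      p′ * (p * q)    ≡⟨ cong (p′ *_) pq≡0 ⟩
      p′ * 0ℚ         ≡⟨ ℚᵖ.*-zeroʳ p′ ⟩
      0ℚ              ∎)
    where open ≡-Reasoning

  infixr 8 _^_
  _^_ : ℚ → ℕ → ℚ
  x ^ zero  = 1ℚ
  x ^ suc n = x * x ^ n

  ^-homo-+ : ∀ x m n → x ^ (m ℕ.+ n) ≡ x ^ m * x ^ n
  ^-homo-+ x zero    n = sym (ℚᵖ.*-identityˡ (x ^ n))
  ^-homo-+ x (suc m) n = trans (cong (x *_) (^-homo-+ x m n)) (sym (ℚᵖ.*-assoc x (x ^ m) (x ^ n)))

  ^-inverse : ∀ {w x} → w * x ≡ 1ℚ → ∀ n → w ^ n * x ^ n ≡ 1ℚ
  ^-inverse {w} {x} wx≡1 zero    = ℚᵖ.*-identityˡ 1ℚ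
  ^-inverse {w} {x} wx≡1 (suc n) = begin
    w * w ^ n * (x * x ^ n)     ≡⟨ solve 4 (λ w x a b → w :* a :* (x :* b) := w :* x :* (a :* b))
                                       refl w x (w ^ n) (x ^ n) ⟩
    w * x * (w ^ n * x ^ n)     ≡⟨ cong₂ _*_ wx≡1 (^-inverse wx≡1 n) ⟩
    1ℚ * 1ℚ                     ≡⟨⟩
    1ℚ                          ∎
    where open ≡-Reasoning

  4ℚ : ℚ
  4ℚ = ⌜ + 4 ⌝

  evalℚ : ℤ[X] → ℚ → ℚ
  evalℚ f = Univariate.eval ℚᵖ.+-*-commutativeRing (List.map ⌜_⌝ f)

  coeff : ℤ[X] → ℕ → ℤ
  coeff = Univariate.coeff ℤᵖ.+-*-commutativeRing

  evalℚ-0 : ∀ f x → (∀ k → coeff f k ≡ ℤ.0ℤ) → evalℚ f x ≡ 0ℚ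
  evalℚ-0 []      x zeros = refl
  evalℚ-0 (a ∷ f) x zeros = begin
    ⌜ a ⌝ + x * evalℚ f x   ≡⟨ cong₂ (λ s t → ⌜ s ⌝ + x * t) (zeros 0)
                                   (evalℚ-0 f x λ k → zeros (suc k)) ⟩
    0ℚ + x * 0ℚ             ≡⟨ cong (λ q → 0ℚ + q) (ℚᵖ.*-zeroʳ x) ⟩
    0ℚ                      ∎
    where open ≡-Reasoning

  -- What a place has to provide for u ↦ δ - u² to be a contraction of a ball
  -- around 0, for all small δ.
  record SquareContraction (T : RingTopology) : Set where
    open RingTopology T
    field
      1-large  : ¬ Small 1 1ℚ
      ∃-small  : ∀ k → ∃[ t ] t ≢ 0ℚ × Small k t
      contract : ∀ n {x y} → Small n x → Small 1 y → Small (suc n) (x * y)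
      b c      : ℕ
      stable   : ∀ {δ u} → Small c δ → Small b u → Small b (δ - u * u)
      ball-+   : ∀ {u v} → Small b u → Small b v → Small 1 (u + v)
      ball--   : ∀ {u v} → Small b u → Small b v → Small 0 (u - v)

  -- Expansion of polynomials at infinity

  module _ (T : RingTopology) where
    open RingTopology T

    Infinitesimal : (ℚ → ℚ) → Set
    Infinitesimal E = ∀ k → ∃[ j ] (∀ {w} → Small j w → Small k (E w))

    inf-id : Infinitesimal (λ w → w)
    inf-id k = k , λ s → s

    inf-+ : ∀ {E F} → Infinitesimal E → Infinitesimal F → Infinitesimal (λ w → E w + F w)
    inf-+ e f k =
      let j , add = small-+ k
          i , e′ = e j
          l , f′ = f j
      in i ℕ.⊔ l , λ s → add (e′ (small-mono (ℕᵖ.m≤m⊔n i l) s)) (f′ (small-mono (ℕᵖ.m≤n⊔m i l) s))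

    inf-* : ∀ {E F} → Infinitesimal E → Infinitesimal F → Infinitesimal (λ w → E w * F w)
    inf-* e f k =
      let j , mul = small-* k
          i , e′ = e j
          l , f′ = f j
      in i ℕ.⊔ l , λ s → mul (e′ (small-mono (ℕᵖ.m≤m⊔n i l) s)) (f′ (small-mono (ℕᵖ.m≤n⊔m i l) s))

    inf-scale : ∀ q {E} → Infinitesimal E → Infinitesimal (λ w → q * E w)
    inf-scale q e k =
      let j , scale = small-scale q k
          i , e′ = e j
      in i , λ s → scale (e′ s)

    inf-∘ : ∀ {E F} → Infinitesimal E → Infinitesimal F → Infinitesimal (λ w → E (F w))
    inf-∘ e f k =
      let j , e′ = e k
          i , f′ = f j
      in i , λ s → e′ (f′ s)

    inf-^ : ∀ n → Infinitesimal (λ w → w ^ suc n)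
    inf-^ zero    k = k , λ {w} s → subst (Small k) (sym (ℚᵖ.*-identityʳ w)) s
    inf-^ (suc n) = inf-* {λ w → w} {λ w → w ^ suc n} inf-id (inf-^ n)

    -- With w = 1/x, wⁿ f(x) is the reversed polynomial aₙ + aₙ₋₁ w + ... + a₀ wⁿ, and `E` is its
    -- part without constant term. The recursion writes f = a + x f₁, so that wⁿ⁺¹ f(x) = a wⁿ⁺¹ +
    -- (w x)(wⁿ f₁(x)).
    leading-term : ∀ f n → (∀ k → n ℕ.< k → coeff f k ≡ ℤ.0ℤ) →
      ∃[ E ] Infinitesimal E × (∀ {w x} → w * x ≡ 1ℚ → w ^ n * evalℚ f x ≡ ⌜ coeff f n ⌝ + E w)
    leading-term [] n _ = (λ _ → 0ℚ) , (λ k → 0 , λ _ → small-0 k) , λ {w} _ → ℚᵖ.*-zeroʳ (w ^ n)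
    -- The tail may be a nonempty list of zeros; its value vanishes all the same.
    leading-term (a ∷ f) zero zeros = (λ _ → 0ℚ) , (λ k → 0 , λ _ → small-0 k) , λ {w} {x} _ → begin
      1ℚ * (⌜ a ⌝ + x * evalℚ f x)
        ≡⟨ cong (λ e → 1ℚ * (⌜ a ⌝ + x * e)) (evalℚ-0 f x λ k → zeros (suc k) (s≤s z≤n)) ⟩
      1ℚ * (⌜ a ⌝ + x * 0ℚ)
        ≡⟨ solve 2 (λ a x → con 1ℚ :* (a :+ x :* con 0ℚ) := a :+ con 0ℚ) refl ⌜ a ⌝ x ⟩
      ⌜ a ⌝ + 0ℚ ∎
      where open ≡-Reasoning
    leading-term (a ∷ f) (suc n) zeros =
      let E , inf , eq = leading-term f n λ k n<k → zeros (suc k) (s≤s n<k)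
      in (λ w → ⌜ a ⌝ * w ^ suc n + E w) ,
         inf-+ {λ w → ⌜ a ⌝ * w ^ suc n} {E} (inf-scale ⌜ a ⌝ {λ w → w ^ suc n} (inf-^ n)) inf ,
         λ {w} {x} wx≡1 → begin
           w * w ^ n * (⌜ a ⌝ + x * evalℚ f x)
             ≡⟨ solve 5 (λ w W a x e → w :* W :* (a :+ x :* e) := a :* (w :* W) :+ w :* x :* (W :* e))
                  refl w (w ^ n) ⌜ a ⌝ x (evalℚ f x) ⟩
           ⌜ a ⌝ * (w * w ^ n) + w * x * (w ^ n * evalℚ f x)
             ≡⟨ cong₂ (λ s t → ⌜ a ⌝ * (w * w ^ n) + s * t) wx≡1 (eq wx≡1) ⟩
           ⌜ a ⌝ * (w * w ^ n) + 1ℚ * (⌜ coeff f n ⌝ + E w)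
             ≡⟨ solve 3 (λ s c e → s :+ con 1ℚ :* (c :+ e) := c :+ (s :+ e))
                  refl (⌜ a ⌝ * (w * w ^ n)) ⌜ coeff f n ⌝ (E w) ⟩
           ⌜ coeff f n ⌝ + (⌜ a ⌝ * (w * w ^ n) + E w) ∎
      where open ≡-Reasoning

    -- Fixed points in the completion and values near infinity

    module _ (contraction : SquareContraction T) where
      open SquareContraction contraction

      -- The limit satisfies u + u² = δ. Seeking u instead of a square root of 1 + 4δ avoids
      -- division by 2, so that the prime 2 is treated like all others.
      iterate : ℚ → ℕ → ℚ
      iterate δ zero    = 0ℚ
      iterate δ (suc n) = δ - iterate δ n * iterate δ n

      module _ {δ : ℚ} (δ-small : Small c δ) where
        private
          u = iterate δ

          u-ball : ∀ n → Small b (u n)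
          u-ball zero    = small-0 b
          u-ball (suc n) = stable δ-small (u-ball n)

        -- The images of x and y differ by -(x - y)(x + y), and x + y lies in `Small 1`, so each
        -- application of the map gains one level.
        iterate-contracts : ∀ k i j → k ℕ.≤ i → k ℕ.≤ j → Small k (u i - u j)
        iterate-contracts zero    i       j       _         _         = ball-- (u-ball i) (u-ball j)
        iterate-contracts (suc k) (suc i) (suc j) (s≤s k≤i) (s≤s k≤j) =
          subst (Small (suc k))
            (solve 3 (λ d x y → :- ((x :- y) :* (x :+ y)) := (d :- x :* x) :- (d :- y :* y))
              refl δ (u i) (u j))
            (small-neg (suc k)
              (contract k (iterate-contracts k i j k≤i k≤j) (ball-+ (u-ball i) (u-ball j))))

      module K = CommutativeRing (Completion.commutativeRing T)
      open Completion T using (const; cauchy; seq)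

      -- Ring operations in the completion act termwise, so questions about the value at a rational
      -- point reduce to ℚ.
      seq-eval : ∀ f x n →
        seq (Univariate.eval (Completion.commutativeRing T) (List.map (λ i → const ⌜ i ⌝) f) (const x)) n
        ≡ evalℚ f x
      seq-eval []      x n = refl
      seq-eval (a ∷ f) x n = cong (λ e → ⌜ a ⌝ + x * e) (seq-eval f x n)

      -- If the constant sequence q tended to 0, so would q′ q = 1, against `1-large`.
      const≉0 : ∀ {q} → q ≢ 0ℚ → ¬ const q K.≈ K.0#
      const≉0 {q} q≢0 q≈0 =
        let q′ , qq′≡1 = inverse q≢0
            j , scale = small-scale q′ 1
            N , small = q≈0 j
        in 1-large (subst (Small 1)
             (trans (solve 2 (λ q q′ → q′ :* (q :- con 0ℚ) := q :* q′) refl q q′) qq′≡1)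
             (scale (small N ℕᵖ.≤-refl)))

      -- Near x = ∞ a polynomial of odd degree takes values in every square class.
      -- Put x = a d / t² with a the leading coefficient and t small.  Then
      -- f(x) = d r² (1 + 4δ) with r = a xʰ / t and δ small, and 1 + 4δ = (1 + 2u)²
      -- for the fixed point u of u ↦ δ - u².
      odd-degree-point : ∀ f h → HasDegree f (suc (h ℕ.+ h)) → ∀ {d} → d ≢ ℤ.0ℤ →
        let fᵥ = Univariate.eval (Completion.commutativeRing T) (List.map (λ i → const ⌜ i ⌝) f) in
        ∃[ x ] ∃[ y ] const ⌜ d ⌝ K.* (y K.* y) K.≈ fᵥ x × ¬ fᵥ x K.≈ K.0#
      odd-degree-point f h (lead , zeros) {dᶻ} dᶻ≢0 =
        const x , y , solution ,
        λ fx≈0 → const≉0 fx≢0 λ k →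
          let N , small = fx≈0 k
          in N , λ m N≤m → subst (λ e → Small k (e - 0ℚ)) (seq-eval f x m) (small m N≤m)
        where
        open ≡-Reasoning
        n = suc (h ℕ.+ h)
        a = ⌜ coeff f n ⌝
        d = ⌜ dᶻ ⌝
        a≢0 : a ≢ 0ℚ
        a≢0 eq = lead (⌜⌝-injective eq)
        d≢0 : d ≢ 0ℚ
        d≢0 eq = dᶻ≢0 (⌜⌝-injective eq)

        -- e = 1/(a d), so that w = e t² is the inverse of x = a d / t².
        ad⁻¹ = inverse (*-≢0 a≢0 d≢0)
        e = proj₁ ad⁻¹
        -- κ = 1/(4a) turns a + E(w) into a (1 + 4δ) with δ = κ E(w).
        4a⁻¹ = inverse (*-≢0 {4ℚ} (λ ()) a≢0)
        κ = proj₁ 4a⁻¹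

        expansion = leading-term f n zeros
        E = proj₁ expansion

        Δ : ℚ → ℚ
        Δ t = κ * E (e * (t * t))

        Δ-inf : Infinitesimal Δ
        Δ-inf = inf-scale κ {λ t → E (e * (t * t))}
          (inf-∘ {E} {λ t → e * (t * t)} (proj₁ (proj₂ expansion))
            (inf-scale e {λ t → t * t} (inf-* {λ t → t} {λ t → t} inf-id inf-id)))

        -- Two demands on t: δ must lie in `Small c`, to keep the iteration in its ball, and -4δ in
        -- `Small 1`, which does not contain 1, to make 1 + 4δ nonzero.
        near-c = Δ-inf c
        near-1 = inf-scale (- 4ℚ) {Δ} Δ-inf 1
        j = proj₁ near-c ℕ.⊔ proj₁ near-1

        t = proj₁ (∃-small j)
        t-small : Small j t
        t-small = proj₂ (proj₂ (∃-small j))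
        t⁻¹ = inverse (proj₁ (proj₂ (∃-small j)))
        s = proj₁ t⁻¹

        w = e * (t * t)
        x = a * d * (s * s)
        δ = Δ t
        X = x ^ h
        r = a * X * s

        δ-small : Small c δ
        δ-small = proj₂ near-c (small-mono (ℕᵖ.m≤m⊔n _ _) t-small)

        -4δ≢1 : - 4ℚ * δ ≢ 1ℚ
        -4δ≢1 eq = 1-large (subst (Small 1) eq
          (proj₂ near-1 (small-mono (ℕᵖ.m≤n⊔m (proj₁ near-c) _) t-small)))

        wx≡1 : w * x ≡ 1ℚ
        wx≡1 = begin
          e * (t * t) * (a * d * (s * s))
            ≡⟨ solve 4 (λ e t ad s → e :* (t :* t) :* (ad :* (s :* s))
                                     := ad :* e :* ((t :* s) :* (t :* s))) refl e t (a * d) s ⟩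
          a * d * e * ((t * s) * (t * s))
            ≡⟨ cong₂ (λ p q → p * (q * q)) (proj₂ ad⁻¹) (proj₂ t⁻¹) ⟩
          1ℚ * (1ℚ * 1ℚ)
            ≡⟨⟩
          1ℚ ∎

        value : w ^ n * evalℚ f x ≡ a * (1ℚ + 4ℚ * δ)
        value = begin
          w ^ n * evalℚ f x             ≡⟨ proj₂ (proj₂ expansion) wx≡1 ⟩
          a + E w                       ≡⟨ cong (λ q → a + q) (ℚᵖ.*-identityˡ (E w)) ⟨
          a + 1ℚ * E w                  ≡⟨ cong (λ q → a + q * E w) (proj₂ 4a⁻¹) ⟨
          a + 4ℚ * a * κ * E w
            ≡⟨ solve 3 (λ a κ E → a :+ con 4ℚ :* a :* κ :* E
                                  := a :* (con 1ℚ :+ con 4ℚ :* (κ :* E))) refl a κ (E w) ⟩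
          a * (1ℚ + 4ℚ * (κ * E w))     ∎

        fx : evalℚ f x ≡ d * (r * r) * (1ℚ + 4ℚ * δ)
        fx = begin
          evalℚ f x
            ≡⟨ ℚᵖ.*-identityˡ _ ⟨
          1ℚ * evalℚ f x
            ≡⟨ cong (_* evalℚ f x) (^-inverse {w} {x} wx≡1 n) ⟨
          w ^ n * x ^ n * evalℚ f x
            ≡⟨ solve 3 (λ p q f → p :* q :* f := q :* (p :* f)) refl (w ^ n) (x ^ n) (evalℚ f x) ⟩
          x ^ n * (w ^ n * evalℚ f x)
            -- Here the degree is odd: xⁿ = x X², and a x = d (a s)² is d times a square.
            ≡⟨ cong₂ (λ p q → x * p * q) (^-homo-+ x h h) value ⟩
          x * (X * X) * (a * (1ℚ + 4ℚ * δ))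
            ≡⟨ solve 5 (λ a d s X v → a :* d :* (s :* s) :* (X :* X) :* (a :* v)
                                   := d :* (a :* X :* s :* (a :* X :* s)) :* v)
                 refl a d s X (1ℚ + 4ℚ * δ) ⟩
          d * (r * r) * (1ℚ + 4ℚ * δ) ∎

        fx≢0 : evalℚ f x ≢ 0ℚ
        fx≢0 eq = *-≢0 a≢0 1+4δ≢0
          (trans (sym value) (trans (cong (w ^ n *_) eq) (ℚᵖ.*-zeroʳ (w ^ n))))
          where
          1+4δ≢0 : 1ℚ + 4ℚ * δ ≢ 0ℚ
          1+4δ≢0 eq = -4δ≢1 (trans
            (solve 1 (λ δ → (:- con 4ℚ) :* δ := con 1ℚ :- (con 1ℚ :+ con 4ℚ :* δ)) refl δ)
            (cong (λ q → 1ℚ - q) eq))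

        u = iterate δ
        -- Gaining one level per iteration makes k itself a Cauchy modulus.
        U = cauchy u λ k → k , λ i j → iterate-contracts δ-small k i j

        -- (1 + 2u)² - (1 + 4δ) = 4 (u - (δ - u²)), so the defect of the m-th approximation is a
        -- fixed multiple of the distance between consecutive iterates, which tends to 0.
        error : ∀ m → 4ℚ * (d * (r * r)) * (u m - u (suc m))
                    ≡ d * (r * (1ℚ + (u m + u m)) * (r * (1ℚ + (u m + u m)))) - evalℚ f x
        error m = trans
          (solve 4 (λ d r δ u → con 4ℚ :* (d :* (r :* r)) :* (u :- (δ :- u :* u))
                      := d :* (r :* (con 1ℚ :+ (u :+ u)) :* (r :* (con 1ℚ :+ (u :+ u))))
                         :- d :* (r :* r) :* (con 1ℚ :+ con 4ℚ :* δ)) refl d r δ (u m))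
          (cong (λ q → d * (r * (1ℚ + (u m + u m)) * (r * (1ℚ + (u m + u m)))) - q) (sym fx))

        y = const r K.* (K.1# K.+ (U K.+ U))

        solution : const d K.* (y K.* y) K.≈
          Univariate.eval (Completion.commutativeRing T) (List.map (λ i → const ⌜ i ⌝) f) (const x)
        solution k =
          let N , scale = small-scale (4ℚ * (d * (r * r))) k
          in N , λ m N≤m → subst (Small k)
               (trans (error m)
                 (cong (λ q → d * (r * (1ℚ + (u m + u m)) * (r * (1ℚ + (u m + u m)))) - q)
                   (sym (seq-eval f x m))))
               (scale (iterate-contracts δ-small N m (suc m) N≤m (ℕᵖ.m≤n⇒m≤1+n N≤m)))

  -- The contraction at the finite places and at the real place

  adic-contraction : ∀ ℓ ℓ-prime → SquareContraction (adic ℓ ℓ-prime)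
  adic-contraction ℓ ℓ-prime = record
    { 1-large  = λ { (a , b , ℓ∤b , eq) → ℓ∤b (subst (λ i → + ℓ ℤᵈ.∣ i)
        (sym (⌜⌝-injective {b} {+ (ℓ ℕ.^ 1) ℤ.* a} (trans (sym (ℚᵖ.*-identityˡ ⌜ b ⌝)) eq)))
        (subst (ℓ ℕᵈ.∣_) (sym (ℤᵖ.abs-* (+ (ℓ ℕ.^ 1)) a))
          (ℕᵈ.∣m⇒∣m*n ℤ.∣ a ∣ (ℕᵈ.m∣m*n {ℓ} 1)))) }
    ; ∃-small  = λ k → ⌜ + (ℓ ℕ.^ k) ⌝
        , (λ eq → ℕ.≢-nonZero⁻¹ (ℓ ℕ.^ k) {{ℕᵖ.m^n≢0 ℓ k}} (ℤᵖ.+-injective (⌜⌝-injective eq)))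
        , + 1 , + 1 , ℓ∤1 , ⌜⌝-* (+ (ℓ ℕ.^ k)) (+ 1)
    ; contract = λ { n {x} {y} (a , b , ℓ∤b , eq) (a′ , b′ , ℓ∤b′ , eq′) →
        a ℤ.* a′ , b ℤ.* b′ , ∤-* b b′ ℓ∤b ℓ∤b′ , (begin
          x * y * ⌜ b ℤ.* b′ ⌝
            ≡⟨ cong (x * y *_) (⌜⌝-* b b′) ⟨
          x * y * (⌜ b ⌝ * ⌜ b′ ⌝)
            ≡⟨ solve 4 (λ x y b b′ → x :* y :* (b :* b′) := x :* b :* (y :* b′))
                 refl x y ⌜ b ⌝ ⌜ b′ ⌝ ⟩
          x * ⌜ b ⌝ * (y * ⌜ b′ ⌝)
            ≡⟨ cong₂ _*_ eq eq′ ⟩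
          ⌜ L n ℤ.* a ⌝ * ⌜ L 1 ℤ.* a′ ⌝
            ≡⟨ ⌜⌝-* (L n ℤ.* a) (L 1 ℤ.* a′) ⟩
          ⌜ L n ℤ.* a ℤ.* (L 1 ℤ.* a′) ⌝
            ≡⟨ cong ⌜_⌝ (lemma (L n) (L 1) a a′) ⟩
          ⌜ L 1 ℤ.* L n ℤ.* (a ℤ.* a′) ⌝
            ≡⟨ cong (λ l → ⌜ l ℤ.* (a ℤ.* a′) ⌝) (L-suc n) ⟨
          ⌜ L (suc n) ℤ.* (a ℤ.* a′) ⌝ ∎) }
    -- ℓ ℤ₍ℓ₎ is closed under sums and products, so one ball serves for both u and δ.
    ; b        = 1
    ; c        = 1
    ; stable   = λ {δ} {u} δ-small u-small →
        proj₂ (small-+ 1) {δ} { - (u * u)} δ-small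
          (small-neg 1 {u * u} (proj₂ (small-* 1) {u} {u} u-small u-small))
    ; ball-+   = λ {u} {v} p q → proj₂ (small-+ 1) {u} {v} p q
    ; ball--   = λ {u} {v} p q → small-mono {0} {1} {u - v} z≤n
        (proj₂ (small-+ 1) {u} { - v} p (small-neg 1 {v} q))
    }
    where
    open ≡-Reasoning
    open RingTopology (adic ℓ ℓ-prime)
    instance _ = Prime.prime⇒nonZero ℓ-prime

    L : ℕ → ℤ
    L k = + (ℓ ℕ.^ k)

    L-suc : ∀ n → L (suc n) ≡ L 1 ℤ.* L n
    L-suc n = trans (cong (λ e → + (e ℕ.* ℓ ℕ.^ n)) (sym (ℕᵖ.*-identityʳ ℓ)))
                    (ℤᵖ.pos-* (ℓ ℕ.^ 1) (ℓ ℕ.^ n))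

    lemma : ∀ l m a a′ → l ℤ.* a ℤ.* (m ℤ.* a′) ≡ m ℤ.* l ℤ.* (a ℤ.* a′)
    lemma = ℤ-Solver.solve-∀

    ℓ∤1 : ¬ ℓ ℕᵈ.∣ 1
    ℓ∤1 ℓ∣1 = Prime.¬prime[1] (subst Prime (ℕᵈ.∣1⇒≡1 ℓ∣1) ℓ-prime)

    ∤-* : ∀ b b′ → ¬ + ℓ ℤᵈ.∣ b → ¬ + ℓ ℤᵈ.∣ b′ → ¬ + ℓ ℤᵈ.∣ b ℤ.* b′
    ∤-* b b′ ℓ∤b ℓ∤b′ ℓ∣bb′ =
      [ ℓ∤b , ℓ∤b′ ]′ (Prime.euclidsLemma ℤ.∣ b ∣ ℤ.∣ b′ ∣ ℓ-prime
        (subst (ℓ ℕᵈ.∣_) (ℤᵖ.abs-* b b′) ℓ∣bb′))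

  archimedean-contraction : SquareContraction archimedean
  archimedean-contraction = record
    { 1-large  = toWitnessFalse {a? = 1ℚ ℚᵖ.≤? inv 1} _
    ; ∃-small  = λ k → inv k , inv≢0 k ,
        ℚᵖ.≤-reflexive (ℚᵖ.0≤p⇒∣p∣≡p (ℚᵖ.nonNegative⁻¹ (inv k) {{inv-nonNeg k}}))
    -- 1/(n+1) · 1/2 = 1/(2n+2) ≤ 1/(n+2).
    ; contract = λ n {x} {y} p q → small-mono {suc n} {1 ℕ.+ n ℕ.* 2} {x * y}
        (ℕᵖ.+-monoʳ-≤ 1 (ℕᵖ.m≤m*n n 2)) (product n 1 {x} {y} p q)
    -- The bounds are |u| ≤ 1/4 and |δ| ≤ 1/8: then |δ - u²| ≤ 1/8 + 1/16 ≤ 1/4, and |u + v| ≤ 1/2.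
    ; b        = 3
    ; c        = 7
    ; stable   = λ {δ} {u} δ-small u-small →
        proj₂ (small-+ 3) {δ} { - (u * u)} δ-small (small-neg 7 {u * u}
          (small-mono {7} {15} {u * u} (ℕᵖ.m≤m+n 7 8) (product 3 3 {u} {u} u-small u-small)))
    ; ball-+   = λ {u} {v} p q → proj₂ (small-+ 1) {u} {v} p q
    ; ball--   = λ {u} {v} p q → small-mono {0} {1} {u - v} z≤n
        (proj₂ (small-+ 1) {u} { - v} p (small-neg 3 {v} q))
    }
    where
    open RingTopology archimedean

    inv : ℕ → ℚ
    inv k = + 1 ℚ./ suc k

    inv-nonNeg : ∀ k → ℚ.NonNegative (inv k)
    inv-nonNeg k = ℚᵖ.normalize-nonNeg 1 (suc k)

    toℚᵘ-inv : ∀ k → ℚ.toℚᵘ (inv k) ℚᵘ.≃ ℚᵘ.mkℚᵘ (+ 1) k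
    toℚᵘ-inv k = ℚᵖ.toℚᵘ-fromℚᵘ (ℚᵘ.mkℚᵘ (+ 1) k)

    inv≢0 : ∀ k → inv k ≢ 0ℚ
    inv≢0 k eq = ℚᵖ.<⇒≢ (ℚᵖ.positive⁻¹ (inv k) {{ℚᵖ.normalize-pos 1 (suc k)}}) (sym eq)

    -- The index on the right comes from (j + 1)(k + 1) = 1 + (k + j (k + 1)).
    inv-* : ∀ j k → inv j * inv k ≡ inv (k ℕ.+ j ℕ.* suc k)
    inv-* j k = ℚᵖ.toℚᵘ-injective (begin
      ℚ.toℚᵘ (inv j * inv k)                ≈⟨ ℚᵖ.toℚᵘ-homo-* (inv j) (inv k) ⟩
      ℚ.toℚᵘ (inv j) ℚᵘ.* ℚ.toℚᵘ (inv k)    ≈⟨ ℚᵘᵖ.*-cong (toℚᵘ-inv j) (toℚᵘ-inv k) ⟩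
      ℚᵘ.mkℚᵘ (+ 1) (k ℕ.+ j ℕ.* suc k)     ≈⟨ toℚᵘ-inv (k ℕ.+ j ℕ.* suc k) ⟨
      ℚ.toℚᵘ (inv (k ℕ.+ j ℕ.* suc k))      ∎)
      where open ℚᵘᵖ.≃-Reasoning

    product : ∀ j k {x y} → Small j x → Small k y → Small (k ℕ.+ j ℕ.* suc k) (x * y)
    product j k {x} {y} p q = begin
      ℚ.∣ x * y ∣           ≡⟨ ℚᵖ.∣p*q∣≡∣p∣*∣q∣ x y ⟩
      ℚ.∣ x ∣ * ℚ.∣ y ∣     ≤⟨ ℚᵖ.*-monoʳ-≤-nonNeg ℚ.∣ y ∣ {{ℚᵖ.∣-∣-nonNeg y}} p ⟩
      inv j * ℚ.∣ y ∣       ≤⟨ ℚᵖ.*-monoˡ-≤-nonNeg (inv j) {{inv-nonNeg j}} q ⟩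
      inv j * inv k         ≡⟨ inv-* j k ⟩
      inv (k ℕ.+ j ℕ.* suc k) ∎
      where open ℚᵖ.≤-Reasoning

  contraction : ∀ v → SquareContraction (topology v)
  contraction ∞            = archimedean-contraction
  contraction (finite ℓ p) = adic-contraction ℓ p

-- Squarefree integers in a residue class

open import Data.Nat.Base using (_+_; _*_; _<_)

-- Counting and the numerical sieve bound

indicator : {A : Set} → Dec A → ℕ
indicator (yes _) = 1
indicator (no  _) = 0

count : {P : ℕ → Set} → Decidable P → ℕ → ℕ
count P? zero    = 0
count P? (suc n) = indicator (P? n) + count P? n

count-⊎ : {P Q R : ℕ → Set} (P? : Decidable P) (Q? : Decidable Q) (R? : Decidable R) →
  (∀ k → P k → Q k ⊎ R k) → ∀ n → count P? n ℕ.≤ count Q? n + count R? n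
count-⊎ P? Q? R? split zero    = z≤n
count-⊎ P? Q? R? split (suc n) = begin
  indicator (P? n) + count P? n
    ≤⟨ ℕᵖ.+-mono-≤ (pointwise (P? n) (Q? n) (R? n)) (count-⊎ P? Q? R? split n) ⟩
  (indicator (Q? n) + indicator (R? n)) + (count Q? n + count R? n)
    ≡⟨ interchange (indicator (Q? n)) (indicator (R? n)) (count Q? n) (count R? n) ⟩
  (indicator (Q? n) + count Q? n) + (indicator (R? n) + count R? n) ∎
  where
  open ℕᵖ.≤-Reasoning
  interchange : ∀ a b c d → (a + b) + (c + d) ≡ (a + c) + (b + d)
  interchange = ℕ-Solver.solve-∀
  pointwise : (p : Dec _) (q : Dec _) (r : Dec _) → indicator p ℕ.≤ indicator q + indicator r
  pointwise (no _)  _       _       = z≤n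
  pointwise (yes _) (yes _) _       = s≤s z≤n
  pointwise (yes _) (no _)  (yes _) = s≤s z≤n
  pointwise (yes p) (no ¬q) (no ¬r) = contradiction (split n p) [ ¬q , ¬r ]′

∃-uncounted : {P : ℕ → Set} (P? : Decidable P) → ∀ n → count P? n < n → ∃[ k ] k < n × ¬ P k
∃-uncounted P? (suc n) c<n with P? n
... | no ¬p = n , ℕᵖ.n<1+n n , ¬p
... | yes _ =
  let k , k<n , ¬p = ∃-uncounted P? n (ℕᵖ.≤-pred c<n)
  in k , ℕᵖ.m<n⇒m<1+n k<n , ¬p

module _ {P : ℕ → Set} (P? : Decidable P) (D : ℕ)
         (separated : ∀ {i j} → i < j → P i → P j → i + D ℕ.≤ j) where

  private
    -- Each of the c gaps below the largest element is at least D. Exhibiting that element lets the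
    -- induction compare it with the next one.
    last : ∀ n c → count P? n ≡ suc c → ∃[ j ] j < n × P j × D * c ℕ.≤ j
    last (suc n) c eq with P? n
    ... | no _ = let j , j<n , p , le = last n c eq in j , ℕᵖ.m<n⇒m<1+n j<n , p , le
    last (suc n) zero    eq | yes p = n , ℕᵖ.n<1+n n , p , subst (ℕ._≤ n) (sym (ℕᵖ.*-zeroʳ D)) z≤n
    last (suc n) (suc c) eq | yes p =
      let j , j<n , q , le = last n c (ℕᵖ.suc-injective eq)
      in n , ℕᵖ.n<1+n n , p , (begin
        D * suc c   ≡⟨ ℕᵖ.*-suc D c ⟩
        D + D * c   ≤⟨ ℕᵖ.+-monoʳ-≤ D le ⟩
        D + j       ≡⟨ ℕᵖ.+-comm D j ⟩
        j + D       ≤⟨ separated j<n q p ⟩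
        n           ∎)
      where open ℕᵖ.≤-Reasoning

  -- This is count ≤ n/D + 1 without denominators; the 1 accounts for the first element, which has
  -- no gap before it.
  count-separated : ∀ n → D * count P? n ℕ.≤ n + D
  count-separated n with count P? n in eq
  ... | zero  = subst (ℕ._≤ n + D) (sym (ℕᵖ.*-zeroʳ D)) z≤n
  ... | suc c = begin
    D * suc c   ≡⟨ ℕᵖ.*-suc D c ⟩
    D + D * c   ≤⟨ ℕᵖ.+-monoʳ-≤ D (ℕᵖ.≤-trans le (ℕᵖ.<⇒≤ j<n)) ⟩
    D + n       ≡⟨ ℕᵖ.+-comm D n ⟩
    n + D       ∎
    where
    open ℕᵖ.≤-Reasoning
    hit = last n c eq
    j<n = proj₁ (proj₂ hit)
    le = proj₂ (proj₂ (proj₂ hit))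

-- The induction step behind Σ_{2≤q≤Q} 1/q² ≤ 3/4 − 1/Q, from 1/q² ≤ 1/(q-1) − 1/q.
sieve-step : ∀ s n S x → let Q = 1 + s; q = 2 + s in
  4 * Q * S + 4 * n ℕ.≤ 3 * n * Q + 4 * Q * s → q * q * x ℕ.≤ n + q * q →
  4 * q * (S + x) + 4 * n ℕ.≤ 3 * n * q + 4 * q * Q
sieve-step s n S x IH hits =
  -- Both sides are multiplied by Q q and increased by 4 n q², so that q² times `IH` and 4 Q times
  -- `hits` combine without subtraction.
  ℕᵖ.*-cancelʳ-≤ _ _ (Q * q) (ℕᵖ.+-cancelʳ-≤ (4 * n * (q * q)) _ _ (begin
    (4 * q * (S + x) + 4 * n) * (Q * q) + 4 * n * (q * q)
      ≡⟨ lemma₁ Q q n S x ⟩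
    q * q * (4 * Q * S + 4 * n) + (4 * Q * (q * q * x) + 4 * n * (Q * q))
      ≤⟨ ℕᵖ.+-mono-≤ (ℕᵖ.*-monoʳ-≤ (q * q) IH)
           (ℕᵖ.+-monoˡ-≤ (4 * n * (Q * q)) (ℕᵖ.*-monoʳ-≤ (4 * Q) hits)) ⟩
    q * q * (3 * n * Q + 4 * Q * s) + (4 * Q * (n + q * q) + 4 * n * (Q * q))
      -- The slack 4 n is n (1/Q - 1/q - 1/q²) = n/(Q q²), multiplied by 4 Q q².
      ≤⟨ ℕᵖ.m≤m+n _ (4 * n) ⟩
    q * q * (3 * n * Q + 4 * Q * s) + (4 * Q * (n + q * q) + 4 * n * (Q * q)) + 4 * n
      ≡⟨ lemma₂ s n ⟩
    (3 * n * q + 4 * q * Q) * (Q * q) + 4 * n * (q * q) ∎))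
  where
  open ℕᵖ.≤-Reasoning
  Q = 1 + s
  q = 2 + s
  lemma₁ : ∀ Q q n S x →
    (4 * q * (S + x) + 4 * n) * (Q * q) + 4 * n * (q * q)
    ≡ q * q * (4 * Q * S + 4 * n) + (4 * Q * (q * q * x) + 4 * n * (Q * q))
  lemma₁ = ℕ-Solver.solve-∀
  lemma₂ : ∀ s n →
    (2 + s) * (2 + s) * (3 * n * (1 + s) + 4 * (1 + s) * s)
      + (4 * (1 + s) * (n + (2 + s) * (2 + s)) + 4 * n * ((1 + s) * (2 + s))) + 4 * n
    ≡ (3 * n * (2 + s) + 4 * (2 + s) * (1 + s)) * ((1 + s) * (2 + s)) + 4 * n * ((2 + s) * (2 + s))
  lemma₂ = ℕ-Solver.solve-∀

-- The rounding total s is at most n/4 once 4 Q < n, so the bound n (3/4 - 1/Q) + s falls below n.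
sieve-total : ∀ s n → let Q = 1 + s in 4 * Q < n → 3 * n * Q + 4 * Q * s < 4 * Q * n + 4 * n
sieve-total s n 4Q<n = begin-strict
  3 * n * Q + 4 * Q * s              ≤⟨ ℕᵖ.+-monoʳ-≤ (3 * n * Q)
                                          (ℕᵖ.*-mono-≤ (ℕᵖ.<⇒≤ 4Q<n) (ℕᵖ.n≤1+n s)) ⟩
  3 * n * Q + n * Q                  <⟨ ℕᵖ.m<m+n _ {4 * n}
                                          (ℕᵖ.≤-trans (ℕᵖ.≤-<-trans z≤n 4Q<n) (ℕᵖ.m≤m+n n _)) ⟩
  3 * n * Q + n * Q + 4 * n          ≡⟨ lemma n Q ⟩
  4 * Q * n + 4 * n                  ∎
  where
  open ℕᵖ.≤-Reasoning
  Q = 1 + s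
  lemma : ∀ n Q → 3 * n * Q + n * Q + 4 * n ≡ 4 * Q * n + 4 * n
  lemma = ℕ-Solver.solve-∀

-- Sieving an arithmetic progression by squares

Squarefree : ℕ → Set
Squarefree c = ∀ k → k * k ℕᵈ.∣ c → k ≡ 1

module _ {p : ℕ} (p-prime : Prime p) (a : ℕ) (p∤a : ¬ p ℕᵈ.∣ a) where
  private
    instance
      p≢0 : ℕ.NonZero p
      p≢0 = Prime.prime⇒nonZero p-prime

    term : ℕ → ℕ
    term k = a + k * p

    Hit : ℕ → ℕ → Set
    Hit q k = q * q ℕᵈ.∣ term k

    hit? : ∀ q → Decidable (Hit q)
    hit? q k = q * q ℕᵈ.∣? term k

    p∤term : ∀ k → ¬ p ℕᵈ.∣ term k
    p∤term k p∣t = p∤a (ℕᵈ.∣m+n∣m⇒∣n (subst (p ℕᵈ.∣_) (ℕᵖ.+-comm a (k * p)) p∣t) (ℕᵈ.n∣m*n k))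

    -- q² divides the difference p (j - i) of the two terms. It is coprime to p, since otherwise p
    -- would divide a term, and hence it divides j - i.
    separated : ∀ q {i j} → i < j → Hit q i → Hit q j → i + q * q ℕ.≤ j
    separated q {i} {j} i<j hᵢ hⱼ = begin
      i + q * q       ≤⟨ ℕᵖ.+-monoʳ-≤ i (ℕᵈ.∣⇒≤ {{ℕ.>-nonZero (ℕᵖ.m<n⇒0<n∸m i<j)}} q²∣j∸i) ⟩
      i + (j ℕ.∸ i)   ≡⟨ ℕᵖ.m+[n∸m]≡n (ℕᵖ.<⇒≤ i<j) ⟩
      j               ∎
      where
      open ℕᵖ.≤-Reasoning
      difference : term j ≡ term i + p * (j ℕ.∸ i)
      difference = trans (cong term (sym (ℕᵖ.m+[n∸m]≡n (ℕᵖ.<⇒≤ i<j)))) (lemma a i (j ℕ.∸ i) p)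
        where
        lemma : ∀ a i d p → a + (i + d) * p ≡ (a + i * p) + p * d
        lemma = ℕ-Solver.solve-∀
      coprime : Coprimality.Coprime (q * q) p
      coprime {d} (d∣q² , d∣p) with Prime.prime⇒irreducible p-prime d∣p
      ... | inj₁ d≡1  = d≡1
      ... | inj₂ refl = contradiction (ℕᵈ.∣-trans d∣q² hᵢ) (p∤term i)
      q²∣j∸i : q * q ℕᵈ.∣ (j ℕ.∸ i)
      q²∣j∸i = Coprimality.coprime-divisor coprime
        (ℕᵈ.∣m+n∣m⇒∣n (subst (q * q ℕᵈ.∣_) difference hⱼ) hᵢ)

    -- The shift by 2 makes the candidates q run over 2 ≤ q ≤ r + 1.
    Bad : ℕ → ℕ → Set
    Bad r k = ∃[ i ] i < r × Hit (2 + i) k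

    bad? : ∀ r → Decidable (Bad r)
    bad? r k = ℕᵖ.anyUpTo? (λ i → hit? (2 + i) k) r

    bad-suc : ∀ r k → Bad (suc r) k → Bad r k ⊎ Hit (2 + r) k
    bad-suc r k (i , i<1+r , h) with ℕᵖ.m≤n⇒m<n∨m≡n (ℕᵖ.≤-pred i<1+r)
    ... | inj₁ i<r  = inj₁ (i , i<r , h)
    ... | inj₂ refl = inj₂ h

    -- n (3/4 − 1/Q) bounds Σ_{2≤q≤Q} n/q², and rounding adds 1 for each q.  Here
    -- Q = 2 + r, and denominators are cleared.
    bad-bound : ∀ n r → 4 * (2 + r) * count (bad? (suc r)) n + 4 * n
                      ℕ.≤ 3 * n * (2 + r) + 4 * (2 + r) * (1 + r)
    -- For Q = 2 the only candidate is q = 2, and 3/4 - 1/2 = 1/4.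
    bad-bound n zero = begin
      8 * count (bad? 1) n + 4 * n
        ≤⟨ ℕᵖ.+-monoˡ-≤ (4 * n) (ℕᵖ.*-monoʳ-≤ 8 (count-⊎ (bad? 1) (bad? 0) (hit? 2) (bad-suc 0) n)) ⟩
      8 * (count (bad? 0) n + count (hit? 2) n) + 4 * n
        ≡⟨ cong (λ c → 8 * (c + count (hit? 2) n) + 4 * n) (none n) ⟩
      8 * count (hit? 2) n + 4 * n
        ≡⟨ lemma₁ (count (hit? 2) n) n ⟩
      2 * (4 * count (hit? 2) n) + 4 * n
        ≤⟨ ℕᵖ.+-monoˡ-≤ (4 * n) (ℕᵖ.*-monoʳ-≤ 2 (count-separated (hit? 2) 4 (separated 2) n)) ⟩
      2 * (n + 4) + 4 * n
        ≡⟨ lemma₂ n ⟩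
      3 * n * 2 + 8 ∎
      where
      open ℕᵖ.≤-Reasoning
      none : ∀ n → count (bad? 0) n ≡ 0
      none zero    = refl
      none (suc n) = none n
      lemma₁ : ∀ c n → 8 * c + 4 * n ≡ 2 * (4 * c) + 4 * n
      lemma₁ = ℕ-Solver.solve-∀
      lemma₂ : ∀ n → 2 * (n + 4) + 4 * n ≡ 3 * n * 2 + 8
      lemma₂ = ℕ-Solver.solve-∀
    bad-bound n (suc r) = ℕᵖ.≤-trans
      (ℕᵖ.+-monoˡ-≤ (4 * n) (ℕᵖ.*-monoʳ-≤ (4 * (3 + r))
        (count-⊎ (bad? (2 + r)) (bad? (1 + r)) (hit? (3 + r)) (bad-suc (1 + r)) n)))
      (sieve-step (1 + r) n (count (bad? (1 + r)) n) (count (hit? (3 + r)) n) (bad-bound n r)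
        (count-separated (hit? (3 + r)) ((3 + r) * (3 + r)) (separated (3 + r)) n))

    few-bad : ∀ r n → 4 * (2 + r) < n → count (bad? (suc r)) n < n
    few-bad r n 4Q<n = ℕᵖ.≰⇒> λ n≤S → ℕᵖ.<⇒≱ (sieve-total (1 + r) n 4Q<n) (begin
      4 * Q * n + 4 * n                      ≤⟨ ℕᵖ.+-monoˡ-≤ (4 * n) (ℕᵖ.*-monoʳ-≤ (4 * Q) n≤S) ⟩
      4 * Q * count (bad? (suc r)) n + 4 * n ≤⟨ bad-bound n r ⟩
      3 * n * Q + 4 * Q * (1 + r)            ∎)
      where
      open ℕᵖ.≤-Reasoning
      Q = 2 + r

    -- If q² divides the nonzero term, then q² < (3 + r)², so q ≤ r + 2; this is exactly the range
    -- covered by `Bad (suc r)`.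
    ¬bad⇒squarefree : ∀ r k → term k < (3 + r) * (3 + r) → ¬ Bad (suc r) k → Squarefree (term k)
    ¬bad⇒squarefree r k small ¬bad = λ
      { zero          0∣t  → contradiction (ℕᵈ.0∣⇒≡0 0∣t) term≢0
      ; (suc zero)    _    → refl
      ; (suc (suc i)) q²∣t → contradiction (i , bounded i q²∣t , q²∣t) ¬bad
      }
      where
      open ℕᵖ.≤-Reasoning
      term≢0 : term k ≢ 0
      term≢0 eq = p∤term k (subst (p ℕᵈ.∣_) (sym eq) (p ℕᵈ.∣0))

      bounded : ∀ i → Hit (2 + i) k → i < suc r
      bounded i q²∣t = ℕᵖ.≰⇒> λ r<i → ℕᵖ.<-irrefl refl (begin-strict
        term k                <⟨ small ⟩
        (3 + r) * (3 + r)     ≤⟨ ℕᵖ.*-mono-≤ (s≤s (s≤s r<i)) (s≤s (s≤s r<i)) ⟩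
        (2 + i) * (2 + i)     ≤⟨ ℕᵈ.∣⇒≤ {{ℕ.≢-nonZero term≢0}} q²∣t ⟩
        term k                ∎)

  ∃-squarefree : ∃[ k ] Squarefree (a + k * p)
  ∃-squarefree =
    -- Among the first 4 (2 + r) + 1 terms, the least number that `few-bad` admits, the largest is a
    -- + 4 (2 + r) p. This is linear in r, and r = a + 4 p puts it below (3 + r)².
    let r = a + 4 * p
        k , k<n , ¬bad = ∃-uncounted (bad? (suc r)) (suc (4 * (2 + r)))
                           (few-bad r (suc (4 * (2 + r))) (ℕᵖ.n<1+n (4 * (2 + r))))
    in k , ¬bad⇒squarefree r k (term-small k (ℕᵖ.≤-pred k<n)) ¬bad
    where
    open ℕᵖ.≤-Reasoning
    lemma : ∀ a p → let r = a + 4 * p in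
      a + 4 * (2 + r) * p + (9 + (5 * a + 16 * p + r * a)) ≡ (3 + r) * (3 + r)
    lemma = ℕ-Solver.solve-∀
    term-small : ∀ k → let r = a + 4 * p in k ℕ.≤ 4 * (2 + r) → term k < (3 + r) * (3 + r)
    term-small k k≤4Q = let r = a + 4 * p in begin-strict
      a + k * p                                               ≤⟨ ℕᵖ.+-monoʳ-≤ a (ℕᵖ.*-monoˡ-≤ p k≤4Q) ⟩
      a + 4 * (2 + r) * p                                     <⟨ ℕᵖ.m<m+n (a + 4 * (2 + r) * p) (s≤s z≤n) ⟩
      a + 4 * (2 + r) * p + (9 + (5 * a + 16 * p + r * a))    ≡⟨ lemma a p ⟩
      (3 + r) * (3 + r)                                       ∎

-- From one squarefree term to infinitely many integers

odd : ∀ {n} → 2 ∤ n → ∃[ h ] n ≡ suc (h + h)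
odd {n} 2∤n with n ℕᵐ.% 2 in eq | ℕᵐ.m%n<n n 2 | ℕᵐ.m≡m%n+[m/n]*n n 2
... | 0 | _ | _ = contradiction (ℕᵈ.m%n≡0⇒n∣m n 2 eq) 2∤n
... | 1 | _ | split = n ℕᵐ./ 2 , trans split (cong suc
  (trans (ℕᵖ.*-comm (n ℕᵐ./ 2) 2) (cong (λ h → n ℕᵐ./ 2 + h) (ℕᵖ.+-identityʳ _))))
... | suc (suc _) | s≤s (s≤s ()) | _

∈⇒∣∙∣≤sum : ∀ {d ds} → d ∈ ds → ℤ.∣ d ∣ ℕ.≤ sum (List.map ℤ.∣_∣ ds)
∈⇒∣∙∣≤sum (here refl) = ℕᵖ.m≤m+n _ _
∈⇒∣∙∣≤sum (there i)   = ℕᵖ.m≤n⇒m≤o+n _ (∈⇒∣∙∣≤sum i)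

Squarefree⇒IsSquarefree : ∀ {n} → Squarefree n → IsSquarefree (+ n)
Squarefree⇒IsSquarefree {n} sf =
  -- Zero is excluded because 4 divides it, which would force 2 = 1.
  (λ n≡0 → contradiction (sf 2 (subst (4 ℕᵈ.∣_) (sym (ℤᵖ.+-injective n≡0)) (4 ℕᵈ.∣0))) λ ()) ,
  λ k k²∣n → sf ℤ.∣ k ∣ (subst (ℕᵈ._∣ n) (ℤᵖ.abs-* k k) k²∣n)

infinitely-many-squarefree : ∀ {p} → Prime p → ∀ m → Coprime m (+ p) →
  InfinitelyMany (λ d → IsSquarefree d × d ≡ m [mod p ])
infinitely-many-squarefree {p} p-prime m coprime ds =
  + t , (λ d∈ds → ℕᵖ.<⇒≱ B≤t (∈⇒∣∙∣≤sum d∈ds)) , Squarefree⇒IsSquarefree squarefree ,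
  ℤˢ.divides (+ B ℤ.+ + k ℤ.- q) (begin
    + (ρ + p * B + k * p) ℤ.- m
      ≡⟨ cong₂ ℤ._-_ t-expansion (ℤᵐ.a≡a%ℕn+[a/ℕn]*n m p) ⟩
    (+ ρ ℤ.+ + p ℤ.* + B ℤ.+ + k ℤ.* + p) ℤ.- (+ ρ ℤ.+ q ℤ.* + p)
      ≡⟨ lemma (+ ρ) (+ p) (+ B) (+ k) q ⟩
    (+ B ℤ.+ + k ℤ.- q) ℤ.* + p ∎)
  where
  open ≡-Reasoning
  instance _ = Prime.prime⇒nonZero p-prime
  ρ = m ℤᵐ.%ℕ p
  q = m ℤᵐ./ℕ p
  -- Starting the progression at ρ + p B makes all its terms exceed every absolute value in `ds`.
  B = suc (sum (List.map ℤ.∣_∣ ds))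

  p∤a : ¬ p ℕᵈ.∣ ρ + p * B
  p∤a p∣a = Prime.¬prime[1] (subst Prime (coprime (p∣m , ℕᵈ.∣-refl)) p-prime)
    where
    p∣ρ : p ℕᵈ.∣ ρ
    p∣ρ = ℕᵈ.∣m+n∣m⇒∣n (subst (p ℕᵈ.∣_) (ℕᵖ.+-comm ρ (p * B)) p∣a) (ℕᵈ.m∣m*n B)
    p∣m : + p ℤᵈ.∣ m
    p∣m = ℤˢ.∣⇒∣ᵤ (subst (+ p ℤˢ.∣_) (sym (ℤᵐ.a≡a%ℕn+[a/ℕn]*n m p))
      (ℤˢ.∣m∣n⇒∣m+n {m = + ρ} (ℤˢ.∣ᵤ⇒∣ p∣ρ) (ℤˢ.∣n⇒∣m*n q ℤˢ.∣-refl)))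

  found = ∃-squarefree p-prime (ρ + p * B) p∤a
  k = proj₁ found
  squarefree = proj₂ found
  t = ρ + p * B + k * p

  B≤t : B ℕ.≤ t
  B≤t = ℕᵖ.≤-trans (ℕᵖ.m≤n*m B p) (ℕᵖ.≤-trans (ℕᵖ.m≤n+m (p * B) ρ) (ℕᵖ.m≤m+n (ρ + p * B) (k * p)))

  t-expansion : + t ≡ + ρ ℤ.+ + p ℤ.* + B ℤ.+ + k ℤ.* + p
  t-expansion = cong₂ (λ i j → + ρ ℤ.+ i ℤ.+ j) (ℤᵖ.pos-* p B) (ℤᵖ.pos-* k p)

  lemma : ∀ r p b k q → (r ℤ.+ p ℤ.* b ℤ.+ k ℤ.* p) ℤ.- (r ℤ.+ q ℤ.* p) ≡ (b ℤ.+ k ℤ.- q) ℤ.* p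
  lemma = ℤ-Solver.solve-∀

open import Data.Integer.Base using (_≤_)

theorem4p4 : (f : ℤ[X]) (n : ℕ) → HasDegree f n → 0 < n → 2 ∤ n → IsSeparable f →
    (g : ℕ) → IsHyperellipticGenus n g →
    (N₀ : ℤ) →
    (∀ ℓ → Prime ℓ → N₀ ≤ + ℓ →
    IsGood f ℓ × ((X : SmoothProjectiveCurve (ℤ/ ℓ) g) → HasAtLeastPoints (ℤ/ ℓ) X (2 * g + 5))) →
    (p : ℕ) → Prime p → N₀ ≤ + p →
    (m : ℤ) → Coprime m (+ p) →
    InfinitelyMany (λ d → IsSquarefree d × d ≡ m [mod p ] × (∀ v → HasNontrivialPoint f d v))
theorem4p4 f n degree _ 2∤n _ _ _ _ _ p p-prime _ m coprime ds =
  let d , d∉ds , squarefree , d≡m = infinitely-many-squarefree p-prime m coprime ds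
      h , n≡1+2h = odd 2∤n
  in d , d∉ds , squarefree , d≡m , λ v →
     -- One d serves all places: local solubility asks for an odd degree 2h + 1 and for d ≠ 0, which
     -- is the first component of `squarefree`.
     odd-degree-point (topology v) (contraction v) f h
       (subst (HasDegree f) n≡1+2h degree) (proj₁ squarefree)
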